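{- Let $L$ be a BL-algebra, $M_L$ its monoid of good sequences and $(G_L,\preceq)$ its Chang group. Then $(G_L,+,\preceq)$ is a lattice-ordered (Abelian) group, and for all $\mathbf{a},\mathbf{b},\mathbf{c},\mathbf{d}\in M_L$, $$[\mathbf{a},\mathbf{b}]\vee[\mathbf{c},\mathbf{d}]=[(\mathbf{a}+\mathbf{d})\vee(\mathbf{b}+\mathbf{c}),\ \mathbf{b}+\mathbf{d}],\qquad [\mathbf{a},\mathbf{b}]\wedge[\mathbf{c},\mathbf{d}]=[(\mathbf{a}+\mathbf{d})\wedge(\mathbf{b}+\mathbf{c}),\ \mathbf{b}+\mathbf{d}],$$ where the joins and meets on the right are taken in $(M_L,\le)$.
   Context: A BL-algebra is an algebra $(L,\wedge,\vee,\otimes,\to,0,1)$ such that $(L,\wedge,\vee,0,1)$ is a bounded lattice, $(L,\otimes,1)$ is a commutative monoid, $x\otimes y\le z$ iff $x\le y\to z$, $x\wedge y=x\otimes(x\to y)$, and $(x\to y)\vee(y\to x)=1$. Put $\bar x=x\to 0$, $x\oslash y=\bar x\to y$, and $x+y=(x\oslash y)\wedge(y\oslash x)$; this $+$ is commutative and associative with identity $0$. A good sequence of $L$ is a sequence $\mathbf{a}=(a_1,a_2,\ldots)$ of elements of $L$ with $a_i+a_{i+1}=a_i$ for all $i$ and $a_r=0$ for all sufficiently large $r$; $(a_1,\dots,a_n)$ denotes $(a_1,\dots,a_n,0,0,\dots)$. The sum of sequences $\mathbf{a},\mathbf{b}$ is $\mathbf{a}+\mathbf{b}=(c_1,c_2,\ldots)$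 with $c_i=a_i+(a_{i-1}\otimes b_1)+\cdots+(a_1\otimes b_{i-1})+b_i$. $M_L$ is the set of good sequences of $L$; it is closed under this sum, and $(M_L,+,(0))$ is a commutative monoid. $M_L$ is ordered componentwise: $\mathbf{a}\le\mathbf{b}$ iff $a_i\le b_i$ for all $i$; componentwise joins/meets of good sequences are good sequences. The Chang group: on $M_L\times M_L$ set $(\mathbf{a},\mathbf{b})\sim(\mathbf{c},\mathbf{d})$ iff there is $\mathbf{k}\in M_L$ with $\mathbf{a}+\mathbf{d}+\mathbf{k}=\mathbf{b}+\mathbf{c}+\mathbf{k}$; $G_L=(M_L\times M_L)/\sim$, the class of $(\mathbf{a},\mathbf{b})$ is $[\mathbf{a},\mathbf{b}]$, $[\mathbf{a},\mathbf{b}]+[\mathbf{c},\mathbf{d}]=[\mathbf{a}+\mathbf{c},\mathbf{b}+\mathbf{d}]$ (an Abelian group with $-[\mathbf{a},\mathbf{b}]=[\mathbf{b},\mathbf{a}]$ and zero $[(0),(0)]$), and $[\mathbf{a},\mathbf{b}]\preceq[\mathbf{c},\mathbf{d}]$ iff there is $\mathbf{k}\in M_L$ with $\mathbf{a}+\mathbf{d}+\mathbf{k}\le\mathbf{b}+\mathbf{c}+\mathbf{k}$. -}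

module Defs where

open import Level using (Level; _⊔_) renaming (suc to lsuc)
open import Data.Nat using (ℕ; zero; suc; _∸_) renaming (_≤_ to _≤ℕ_)
open import Data.Product using (Σ; ∃; _×_; _,_; proj₁; proj₂)
open import Relation.Binary.PropositionalEquality using (_≡_)
open import Algebra.Lattice.Structures using (IsLattice)
open import Algebra.Structures using (IsCommutativeMonoid)

record BLAlgebra (c : Level) : Set (lsuc c) where
  infixr 7 _⊗_
  infixr 6 _∧_
  infixr 5 _∨_
  infixr 4 _⇒_
  field
    Carrier : Set c
    _∧_ _∨_ _⊗_ _⇒_ : Carrier → Carrier → Carrier
    𝟘 𝟙 : Carrier

  infix 2 _≤_
  _≤_ : Carrier → Carrier → Set c
  x ≤ y = (x ∧ y) ≡ x

  field
    isLattice : IsLattice _≡_ _∨_ _∧_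
    𝟘-least    : ∀ x → 𝟘 ≤ x
    𝟙-greatest : ∀ x → x ≤ 𝟙
    ⊗-isCommutativeMonoid : IsCommutativeMonoid _≡_ _⊗_ 𝟙
    residuation₁ : ∀ x y z → (x ⊗ y) ≤ z → x ≤ (y ⇒ z)
    residuation₂ : ∀ x y z → x ≤ (y ⇒ z) → (x ⊗ y) ≤ z
    divisibility : ∀ x y → x ∧ y ≡ x ⊗ (x ⇒ y)
    prelinearity : ∀ x y → (x ⇒ y) ∨ (y ⇒ x) ≡ 𝟙

  ¬_ : Carrier → Carrier
  ¬ x = x ⇒ 𝟘

  _⊘_ : Carrier → Carrier → Carrier
  x ⊘ y = (¬ x) ⇒ y

  infixl 3 _⊕_
  _⊕_ : Carrier → Carrier → Carrier
  x ⊕ y = (x ⊘ y) ∧ (y ⊘ x)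

-- Good sequences and the Chang group of a BL-algebra.
-- A sequence (a₁, a₂, …) is represented by a function ℕ → Carrier,
-- with the value at index n being a_{n+1} (0-based indexing).

module ChangGroup {c : Level} (L : BLAlgebra c) where
  open BLAlgebra L

  Seq : Set c
  Seq = ℕ → Carrier

  IsGood : Seq → Set c
  IsGood a = (∀ i → (a i ⊕ a (suc i)) ≡ a i)
           × ∃ λ N → ∀ r → N ≤ℕ r → a r ≡ 𝟘

  0ₛ : Seq
  0ₛ _ = 𝟘

  -- sum of sequences:
  -- c_i = a_i ⊕ (a_{i-1} ⊗ b_1) ⊕ ⋯ ⊕ (a_1 ⊗ b_{i-1}) ⊕ b_i
  -- (in 0-based indexing: c n = a n ⊕ (a (n-1) ⊗ b 0) ⊕ ⋯ ⊕ (a 0 ⊗ b (n-1)) ⊕ b n)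
  partialSum : Seq → Seq → ℕ → ℕ → Carrier
  partialSum a b n zero    = a n
  partialSum a b n (suc j) = partialSum a b n j ⊕ (a (n ∸ suc j) ⊗ b j)

  infixl 6 _+ₛ_
  _+ₛ_ : Seq → Seq → Seq
  (a +ₛ b) n = partialSum a b n n ⊕ b n

  infix 4 _≐_ _≤ₛ_
  _≐_ : Seq → Seq → Set c
  a ≐ b = ∀ i → a i ≡ b i

  _≤ₛ_ : Seq → Seq → Set c
  a ≤ₛ b = ∀ i → a i ≤ b i

  _∨ₛ_ : Seq → Seq → Seq
  (a ∨ₛ b) i = a i ∨ b i

  _∧ₛ_ : Seq → Seq → Seq
  (a ∧ₛ b) i = a i ∧ b i

  -- Representatives of elements of G_L: pairs (a , b) of sequences,
  -- standing for the class [a , b].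
  Pair : Set c
  Pair = Seq × Seq

  GoodPair : Pair → Set c
  GoodPair (a , b) = IsGood a × IsGood b

  infix 4 _∼_ _⪯_
  _∼_ : Pair → Pair → Set c
  (a , b) ∼ (c' , d) = ∃ λ k → IsGood k × (a +ₛ d +ₛ k ≐ b +ₛ c' +ₛ k)

  _⪯_ : Pair → Pair → Set c
  (a , b) ⪯ (c' , d) = ∃ λ k → IsGood k × (a +ₛ d +ₛ k ≤ₛ b +ₛ c' +ₛ k)

  infixl 6 _⊞_
  _⊞_ : Pair → Pair → Pair
  (a , b) ⊞ (c' , d) = (a +ₛ c' , b +ₛ d)

  ⊟_ : Pair → Pair
  ⊟ (a , b) = (b , a)

  𝟎 : Pair
  𝟎 = (0ₛ , 0ₛ)

  joinRep : Pair → Pair → Pair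
  joinRep (a , b) (c' , d) = ((a +ₛ d) ∨ₛ (b +ₛ c') , b +ₛ d)

  meetRep : Pair → Pair → Pair
  meetRep (a , b) (c' , d) = ((a +ₛ d) ∧ₛ (b +ₛ c') , b +ₛ d)

  -- (G_L, +, ⪯) is a lattice-ordered Abelian group, with the joins and
  -- meets given by joinRep / meetRep.  Everything is stated on
  -- representatives (pairs of good sequences) modulo ∼, since Agda has
  -- no quotient types.
  record IsChangLGroup : Set c where
    field
      +ₛ-good : ∀ {a b} → IsGood a → IsGood b → IsGood (a +ₛ b)
      ∨ₛ-good : ∀ {a b} → IsGood a → IsGood b → IsGood (a ∨ₛ b)
      ∧ₛ-good : ∀ {a b} → IsGood a → IsGood b → IsGood (a ∧ₛ b)
      0ₛ-good : IsGood 0ₛ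
      ∼-refl  : ∀ {x} → GoodPair x → x ∼ x
      ∼-sym   : ∀ {x y} → GoodPair x → GoodPair y → x ∼ y → y ∼ x
      ∼-trans : ∀ {x y z} → GoodPair x → GoodPair y → GoodPair z →
                x ∼ y → y ∼ z → x ∼ z
      ⊞-cong     : ∀ {x x' y y'} → GoodPair x → GoodPair x' → GoodPair y → GoodPair y' →
                   x ∼ x' → y ∼ y' → x ⊞ y ∼ x' ⊞ y'
      ⊞-assoc    : ∀ {x y z} → GoodPair x → GoodPair y → GoodPair z →
                   (x ⊞ y) ⊞ z ∼ x ⊞ (y ⊞ z)
      ⊞-comm     : ∀ {x y} → GoodPair x → GoodPair y → x ⊞ y ∼ y ⊞ x
      ⊞-identity : ∀ {x} → GoodPair x → 𝟎 ⊞ x ∼ x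
      ⊞-inverse  : ∀ {x} → GoodPair x → (⊟ x) ⊞ x ∼ 𝟎
      ⪯-resp-∼   : ∀ {x x' y y'} → GoodPair x → GoodPair x' → GoodPair y → GoodPair y' →
                   x ∼ x' → y ∼ y' → x ⪯ y → x' ⪯ y'
      ⪯-refl     : ∀ {x} → GoodPair x → x ⪯ x
      ⪯-trans    : ∀ {x y z} → GoodPair x → GoodPair y → GoodPair z →
                   x ⪯ y → y ⪯ z → x ⪯ z
      ⪯-antisym  : ∀ {x y} → GoodPair x → GoodPair y → x ⪯ y → y ⪯ x → x ∼ y
      ⪯-⊞        : ∀ {x y z} → GoodPair x → GoodPair y → GoodPair z →
                   x ⪯ y → x ⊞ z ⪯ y ⊞ z
      join-upperˡ : ∀ {x y} → GoodPair x → GoodPair y → x ⪯ joinRep x y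
      join-upperʳ : ∀ {x y} → GoodPair x → GoodPair y → y ⪯ joinRep x y
      join-least  : ∀ {x y z} → GoodPair x → GoodPair y → GoodPair z →
                    x ⪯ z → y ⪯ z → joinRep x y ⪯ z
      meet-lowerˡ : ∀ {x y} → GoodPair x → GoodPair y → meetRep x y ⪯ x
      meet-lowerʳ : ∀ {x y} → GoodPair x → GoodPair y → meetRep x y ⪯ y
      meet-greatest : ∀ {x y z} → GoodPair x → GoodPair y → GoodPair z →
                      z ⪯ x → z ⪯ y → z ⪯ meetRep x y

{-# OPTIONS --safe #-}
-- Chains.  By prelinearity an inequality holds in L as soon as it holds in the two quotients
-- in which x ≤ y, respectively y ≤ x, is forced.  Iterating this replaces the subdirect
-- representation of L by chains: for each single inequality L may be treated as a chain, where
-- every element is either MV (¬¬x = x) or dense (¬x = 0) and every good sequence is (1, …, 1, x).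
--
-- M_L need not be associative.  In the ordinal sum 0 < y < x < 1 of the three-element MV-chain and
-- a two-element Gödel chain, ((x) + (y)) + (y) = (1, 1) but (x) + ((y) + (y)) = (1, x).  Associativity
-- does hold among sequences of MV elements and among sequences of elements that are 0 or dense;
-- both form distributive lattice-ordered monoids, and the first one is cancellative.
--
-- Hence every law is derived in an arbitrary such monoid, up to a common summand T, and
-- transferred to L with a one-term sequence as the witness k of ∼ or ⪯.  Let κ be the join of all
-- e ∧ ¬e, e ranging over the entries of the sequences involved.  Where κ = 0 all entries are 0 or
-- dense, and k acts like T up to terms equal to 1.  Elsewhere k lies strictly inside the MV-component;
-- adding it turns dense last terms into 1, so that a + k = ¬¬a + k and cancellation of T among the
-- MV sequences ¬¬a suffices.
module Submission where

open import Level using (Level) renaming (suc to lsuc)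
open import Data.Fin using (Fin; zero; suc; fromℕ<; toℕ)
open import Data.Fin.Patterns
open import Data.Fin.Properties using (toℕ-fromℕ<)
open import Data.Vec.Functional using (foldr)
open import Data.Vec using (Vec; []; _∷_; lookup)
open import Data.List using (List; []; _∷_)
open import Data.List.Relation.Unary.All as All using (All; []; _∷_)
open import Data.Nat using (ℕ; zero; suc; _+_; _∸_; z≤n; s≤s) renaming (_≤_ to _≤ℕ_)
open import Data.Nat.Properties
  using (_<?_; ≮⇒≥; m≤n⇒m≤1+n; +-∸-assoc; n∸n≡0; +-comm; +-assoc; +-identityʳ; +-mono-≤; m≤m+n; m≤n+m)
  renaming (≤-refl to ≤ℕ-refl; ≤-trans to ≤ℕ-trans)
open import Data.Product using (Σ; ∃; _×_; _,_; proj₁; proj₂)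
open import Data.Sum using (_⊎_; inj₁; inj₂)
open import Relation.Nullary using (yes; no)
open import Relation.Binary.PropositionalEquality using (_≡_; refl; sym; trans; cong; cong₂)
open import Algebra.Bundles using (CommutativeMonoid)
open import Algebra.Lattice.Structures using (IsLattice)
open import Defs

-- Lattice-ordered commutative monoids and terms over them.

record LatticeMonoid (c : Level) : Set (lsuc c) where
  no-eta-equality
  field
    commutativeMonoid : CommutativeMonoid c c
  open CommutativeMonoid commutativeMonoid public using (Carrier; _≈_; _∙_; ε)
  infix 4 _≲_
  infixr 6 _⊔_ _⊓_
  field
    _≲_ : Carrier → Carrier → Set c
    _⊔_ _⊓_ : Carrier → Carrier → Carrier
    ≲-reflexive : ∀ {x y} → x ≈ y → x ≲ y
    ≲-trans : ∀ {x y z} → x ≲ y → y ≲ z → x ≲ z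
    ∙-mono : ∀ {x x' y y'} → x ≲ x' → y ≲ y' → x ∙ y ≲ x' ∙ y'
    x≲x⊔y : ∀ {x y} → x ≲ x ⊔ y
    y≲x⊔y : ∀ {x y} → y ≲ x ⊔ y
    ⊔-least : ∀ {x y z} → x ≲ z → y ≲ z → x ⊔ y ≲ z
    x⊓y≲x : ∀ {x y} → x ⊓ y ≲ x
    x⊓y≲y : ∀ {x y} → x ⊓ y ≲ y
    ⊓-greatest : ∀ {x y z} → z ≲ x → z ≲ y → z ≲ x ⊓ y
    -- Both distributive laws are stated in the direction that monotonicity does not give.
    ∙-distrib-⊔ : ∀ {x y z} → (x ⊔ y) ∙ z ≲ (x ∙ z) ⊔ (y ∙ z)
    ∙-distrib-⊓ : ∀ {x y z} → (x ∙ z) ⊓ (y ∙ z) ≲ (x ⊓ y) ∙ z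

-- Laws are reified because one term is read in several structures: in monoids of sequences over a
-- class, and in raw sequences of `L`, doubly negated or not.
data Expr (n : ℕ) : Set where
  var : Fin n → Expr n
  null : Expr n
  _⊹_ _⊻_ _⊼_ : Expr n → Expr n → Expr n

infixl 6 _⊹_
infixl 5 _⊻_ _⊼_

evaluate : ∀ {c n} (M : LatticeMonoid c) → (Fin n → LatticeMonoid.Carrier M) → Expr n → LatticeMonoid.Carrier M
evaluate M σ (var j) = σ j
evaluate M σ null = LatticeMonoid.ε M
evaluate M σ (e ⊹ f) = LatticeMonoid._∙_ M (evaluate M σ e) (evaluate M σ f)
evaluate M σ (e ⊻ f) = LatticeMonoid._⊔_ M (evaluate M σ e) (evaluate M σ f)
evaluate M σ (e ⊼ f) = LatticeMonoid._⊓_ M (evaluate M σ e) (evaluate M σ f)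

Holds : ∀ {c n} (M : LatticeMonoid c) → (Fin n → LatticeMonoid.Carrier M) → Expr n × Expr n → Set c
Holds M σ (e , f) = LatticeMonoid._≲_ M (evaluate M σ e) (evaluate M σ f)

-- Calculation in a BL-algebra modulo a principal filter.

module Order {c : Level} (L : BLAlgebra c) where
  open BLAlgebra L
  open IsLattice isLattice using (∨-comm; ∧-comm; ∧-assoc; ∨-absorbs-∧; ∧-absorbs-∨)

  ⊗-commutativeMonoid : CommutativeMonoid c c
  ⊗-commutativeMonoid = record { isCommutativeMonoid = ⊗-isCommutativeMonoid }

  open CommutativeMonoid ⊗-commutativeMonoid public using ()
    renaming (assoc to ⊗-assoc; comm to ⊗-comm; identityˡ to ⊗-identityˡ; identityʳ to ⊗-identityʳ)
  open import Algebra.Properties.CommutativeSemigroup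
    (CommutativeMonoid.commutativeSemigroup ⊗-commutativeMonoid) public
    using (interchange; x∙yz≈y∙xz; xy∙z≈xz∙y)
  open import Algebra.Properties.CommutativeMonoid.Mult ⊗-commutativeMonoid
    renaming (_×_ to _times_)

  infixr 8 _^_
  _^_ : Carrier → ℕ → Carrier
  u ^ n = n times u

  ≤-refl : ∀ {x} → x ≤ x
  ≤-refl {x} = trans (cong (x ∧_) (sym (∨-absorbs-∧ x x))) (∧-absorbs-∨ x (x ∧ x))

  ≤-trans : ∀ {x y z} → x ≤ y → y ≤ z → x ≤ z
  ≤-trans {x} {y} {z} p q = trans (cong (_∧ z) (sym p)) (trans (∧-assoc x y z) (trans (cong (x ∧_) q) p))

  ≤-antisym : ∀ {x y} → x ≤ y → y ≤ x → x ≡ y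
  ≤-antisym {x} {y} p q = trans (sym p) (trans (∧-comm x y) q)

  ≡⇒≤ : ∀ {x y} → x ≡ y → x ≤ y
  ≡⇒≤ refl = ≤-refl

  x∧y≤x : ∀ {x y} → (x ∧ y) ≤ x
  x∧y≤x {x} {y} = trans (∧-comm (x ∧ y) x) (trans (sym (∧-assoc x x y)) (cong (_∧ y) ≤-refl))

  x∧y≤y : ∀ {x y} → (x ∧ y) ≤ y
  x∧y≤y {x} {y} = trans (∧-assoc x y y) (cong (x ∧_) ≤-refl)

  ∧-greatest : ∀ {x y z} → z ≤ x → z ≤ y → z ≤ (x ∧ y)
  ∧-greatest {x} {y} {z} p q = trans (sym (∧-assoc z x y)) (trans (cong (_∧ y) p) q)

  x≤x∨y : ∀ {x y} → x ≤ (x ∨ y)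
  x≤x∨y {x} {y} = ∧-absorbs-∨ x y

  y≤x∨y : ∀ {x y} → y ≤ (x ∨ y)
  y≤x∨y {x} {y} = trans (cong (y ∧_) (∨-comm x y)) (∧-absorbs-∨ y x)

  ∨-least : ∀ {x y z} → x ≤ z → y ≤ z → (x ∨ y) ≤ z
  ∨-least {x} {y} {z} p q = trans (cong ((x ∨ y) ∧_) (sym z-absorbs)) (∧-absorbs-∨ (x ∨ y) z)
    where
    absorb : ∀ {w} → w ≤ z → w ∨ z ≡ z
    absorb {w} r = trans (cong (_∨ z) (trans (sym r) (∧-comm w z)))
                         (trans (∨-comm (z ∧ w) z) (∨-absorbs-∧ z w))
    z-absorbs : (x ∨ y) ∨ z ≡ z
    z-absorbs = trans (IsLattice.∨-assoc isLattice x y z) (trans (cong (x ∨_) (absorb q)) (absorb p))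

  ⊗-monoˡ : ∀ {x x' y} → x ≤ x' → (x ⊗ y) ≤ (x' ⊗ y)
  ⊗-monoˡ {x} {x'} {y} p = residuation₂ x y (x' ⊗ y) (≤-trans p (residuation₁ x' y _ ≤-refl))

  ⊗-mono : ∀ {x x' y y'} → x ≤ x' → y ≤ y' → (x ⊗ y) ≤ (x' ⊗ y')
  ⊗-mono {x} {x'} {y} {y'} p q =
    ≤-trans (⊗-monoˡ p) (≤-trans (≡⇒≤ (⊗-comm x' y)) (≤-trans (⊗-monoˡ q) (≡⇒≤ (⊗-comm y' x'))))

  ⊗-dropˡ : ∀ {x y} → (x ⊗ y) ≤ y
  ⊗-dropˡ {x} {y} = ≤-trans (⊗-monoˡ (𝟙-greatest x)) (≡⇒≤ (⊗-identityˡ y))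

  ⊗-dropʳ : ∀ {x y} → (x ⊗ y) ≤ x
  ⊗-dropʳ {x} {y} = ≤-trans (≡⇒≤ (⊗-comm x y)) ⊗-dropˡ

  ∨-elim-⊗ : ∀ {x y z t} → (x ⊗ z) ≤ t → (y ⊗ z) ≤ t → ((x ∨ y) ⊗ z) ≤ t
  ∨-elim-⊗ {x} {y} {z} {t} p q =
    residuation₂ _ z t (∨-least (residuation₁ x z t p) (residuation₁ y z t q))

  -- Expand `(x ∨ y) ⊗ (x ∨ z) = 𝟙`: every product with a factor `x` lies below `x`, which leaves
  -- `y ⊗ z`.
  ∨≡𝟙-⊗ : ∀ {x y z} → x ∨ y ≡ 𝟙 → x ∨ z ≡ 𝟙 → x ∨ (y ⊗ z) ≡ 𝟙
  ∨≡𝟙-⊗ {x} {y} {z} p q = ≤-antisym (𝟙-greatest _)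
    (≤-trans (≡⇒≤ (sym (trans (cong₂ _⊗_ p q) (⊗-identityˡ 𝟙))))
      (∨-elim-⊗ (≤-trans ⊗-dropʳ x≤x∨y)
        (≤-trans (≡⇒≤ (⊗-comm y _))
          (∨-elim-⊗ (≤-trans ⊗-dropʳ x≤x∨y) (≤-trans (≡⇒≤ (⊗-comm z y)) y≤x∨y)))))

  ∨≡𝟙-^ : ∀ {x y} n → x ∨ y ≡ 𝟙 → x ∨ y ^ n ≡ 𝟙
  ∨≡𝟙-^ zero p = ≤-antisym (𝟙-greatest _) y≤x∨y
  ∨≡𝟙-^ (suc n) p = ∨≡𝟙-⊗ p (∨≡𝟙-^ n p)

  ∨≡𝟙-^^ : ∀ {x y} m n → x ∨ y ≡ 𝟙 → x ^ m ∨ y ^ n ≡ 𝟙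
  ∨≡𝟙-^^ {x} {y} m n p =
    trans (∨-comm _ _) (∨≡𝟙-^ m (trans (∨-comm _ _) (∨≡𝟙-^ n p)))

  -- x ⊑[ u ] y says that x ≤ y holds in the quotient of L by the filter generated by u.
  infix 2 _⊑[_]_ _≈[_]_
  record _⊑[_]_ (x u y : Carrier) : Set c where
    constructor _&_
    field
      exponent : ℕ
      bound : (u ^ exponent ⊗ x) ≤ y

  record _≈[_]_ (x u y : Carrier) : Set c where
    constructor _&_
    field
      to : x ⊑[ u ] y
      from : y ⊑[ u ] x
  open _≈[_]_ public

  ≤⇒⊑ : ∀ {u x y} → x ≤ y → x ⊑[ u ] y
  ≤⇒⊑ {u} {x} p = 0 & ≤-trans (≡⇒≤ (⊗-identityˡ x)) p

  ≡⇒⊑ : ∀ {u x y} → x ≡ y → x ⊑[ u ] y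
  ≡⇒⊑ p = ≤⇒⊑ (≡⇒≤ p)

  ≡⇒≈ : ∀ {u x y} → x ≡ y → x ≈[ u ] y
  ≡⇒≈ p = ≡⇒⊑ p & ≡⇒⊑ (sym p)

  𝟙^ : ∀ n → 𝟙 ^ n ≡ 𝟙
  𝟙^ zero = refl
  𝟙^ (suc n) = trans (⊗-identityˡ _) (𝟙^ n)

  ⊑⇒≤ : ∀ {x y} → x ⊑[ 𝟙 ] y → x ≤ y
  ⊑⇒≤ {x} (n & p) = ≤-trans (≡⇒≤ (sym (trans (cong (_⊗ x) (𝟙^ n)) (⊗-identityˡ x)))) p

  ≈⇒≡ : ∀ {x y} → x ≈[ 𝟙 ] y → x ≡ y
  ≈⇒≡ (p & q) = ≤-antisym (⊑⇒≤ p) (⊑⇒≤ q)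

  ⊑-refl : ∀ {u x} → x ⊑[ u ] x
  ⊑-refl = ≤⇒⊑ ≤-refl

  ^-weakenˡ : ∀ u m n → (u ^ (m + n)) ≤ (u ^ m)
  ^-weakenˡ u m n = ≤-trans (≡⇒≤ (×-homo-+ u m n)) ⊗-dropʳ

  ^-weakenʳ : ∀ u m n → (u ^ (m + n)) ≤ (u ^ n)
  ^-weakenʳ u m n = ≤-trans (≡⇒≤ (×-homo-+ u m n)) ⊗-dropˡ

  ⊑-trans : ∀ {u x y z} → x ⊑[ u ] y → y ⊑[ u ] z → x ⊑[ u ] z
  ⊑-trans {u} {x} (m & p) (n & q) = (n + m) &
    ≤-trans (≡⇒≤ (trans (cong (_⊗ x) (×-homo-+ u n m)) (⊗-assoc _ _ x)))
      (≤-trans (⊗-mono ≤-refl p) q)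

  infixr 4 _⨾_
  _⨾_ : ∀ {u x y z} → x ⊑[ u ] y → y ⊑[ u ] z → x ⊑[ u ] z
  _⨾_ = ⊑-trans

  ≈-refl : ∀ {u x} → x ≈[ u ] x
  ≈-refl = ⊑-refl & ⊑-refl

  ≈-sym : ∀ {u x y} → x ≈[ u ] y → y ≈[ u ] x
  ≈-sym (p & q) = q & p

  ≈-trans : ∀ {u x y z} → x ≈[ u ] y → y ≈[ u ] z → x ≈[ u ] z
  ≈-trans (p & q) (p' & q') = (p ⨾ p') & (q' ⨾ q)

  𝟘-min : ∀ {u x} → 𝟘 ⊑[ u ] x
  𝟘-min = ≤⇒⊑ (𝟘-least _)

  𝟙-max : ∀ {u x} → x ⊑[ u ] 𝟙
  𝟙-max = ≤⇒⊑ (𝟙-greatest _)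

  ∧ˡ : ∀ {u x y} → x ∧ y ⊑[ u ] x
  ∧ˡ = ≤⇒⊑ x∧y≤x

  ∧ʳ : ∀ {u x y} → x ∧ y ⊑[ u ] y
  ∧ʳ = ≤⇒⊑ x∧y≤y

  ∧-glb : ∀ {u x y z} → z ⊑[ u ] x → z ⊑[ u ] y → z ⊑[ u ] x ∧ y
  ∧-glb {u} (m & p) (n & q) = (m + n) &
    ∧-greatest (≤-trans (⊗-mono (^-weakenˡ u m n) ≤-refl) p) (≤-trans (⊗-mono (^-weakenʳ u m n) ≤-refl) q)

  ∨ˡ : ∀ {u x y} → x ⊑[ u ] x ∨ y
  ∨ˡ = ≤⇒⊑ x≤x∨y

  ∨ʳ : ∀ {u x y} → y ⊑[ u ] x ∨ y
  ∨ʳ = ≤⇒⊑ y≤x∨y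

  ⊗-swap⊑ : ∀ {u x y} → x ⊗ y ⊑[ u ] y ⊗ x
  ⊗-swap⊑ = ≡⇒⊑ (⊗-comm _ _)

  ⊗-mono⊑ : ∀ {u x x' y y'} → x ⊑[ u ] x' → y ⊑[ u ] y' → x ⊗ y ⊑[ u ] x' ⊗ y'
  ⊗-mono⊑ {u} {x} {y = y} (m & p) (n & q) = (m + n) &
    ≤-trans (≡⇒≤ (trans (cong (_⊗ (x ⊗ y)) (×-homo-+ u m n)) (interchange _ _ x y))) (⊗-mono p q)

  ⇒-intro : ∀ {u x y z} → x ⊗ y ⊑[ u ] z → x ⊑[ u ] y ⇒ z
  ⇒-intro {x = x} {y} (n & p) = n & residuation₁ _ y _ (≤-trans (≡⇒≤ (⊗-assoc _ x y)) p)

  ⇒-elim : ∀ {u x y z} → x ⊑[ u ] y ⇒ z → x ⊗ y ⊑[ u ] z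
  ⇒-elim {x = x} {y} (n & p) = n & ≤-trans (≡⇒≤ (sym (⊗-assoc _ x y))) (residuation₂ _ y _ p)

  ∨-lub : ∀ {u x y z} → x ⊑[ u ] z → y ⊑[ u ] z → x ∨ y ⊑[ u ] z
  ∨-lub {u} {x} {y} {z} (m & p) (n & q) = (m + n) &
    ≤-trans (≡⇒≤ (⊗-comm _ _)) (∨-elim-⊗
      (≤-trans (≡⇒≤ (⊗-comm _ _)) (≤-trans (⊗-mono (^-weakenˡ u m n) ≤-refl) p))
      (≤-trans (≡⇒≤ (⊗-comm _ _)) (≤-trans (⊗-mono (^-weakenʳ u m n) ≤-refl) q)))

  divide : ∀ {u x y} → x ⊑[ u ] y → x ⊑[ u ] y ⊗ (y ⇒ x)
  divide {x = x} {y} p = ∧-glb p ⊑-refl ⨾ ≡⇒⊑ (divisibility y x)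

  infix 2 _≼_
  -- The filter of `v` contains that of `u`. The relation is given by its effect on inequalities, so
  -- that no exponents are handled when facts move to a further quotient.
  record _≼_ (v u : Carrier) : Set c where
    field
      lift : ∀ {x y} → x ⊑[ u ] y → x ⊑[ v ] y
  open _≼_ public

  lift≈ : ∀ {u v x y} → v ≼ u → x ≈[ u ] y → x ≈[ v ] y
  lift≈ e (p & q) = lift e p & lift e q

  ≼-refl : ∀ {u} → u ≼ u
  ≼-refl = record { lift = λ p → p }

  ≼-trans : ∀ {u v w} → w ≼ v → v ≼ u → w ≼ u
  ≼-trans e f = record { lift = λ p → lift e (lift f p) }

  𝟙-≼ : ∀ {u} → u ≼ 𝟙
  𝟙-≼ = record { lift = λ p → ≤⇒⊑ (⊑⇒≤ p) }

  ⊗-≼ : ∀ {u p} → u ⊗ p ≼ u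
  ⊗-≼ {u} {p} = record { lift = λ { {x} (n & h) → n &
    ≤-trans (⊗-mono (≤-trans (≡⇒≤ (×-distrib-+ u p n)) ⊗-dropʳ) ≤-refl) h } }

  ⇒-forced : ∀ {u x y} → x ⊑[ u ⊗ (x ⇒ y) ] y
  ⇒-forced {u} {x} {y} = 1 & ≤-trans (⊗-mono (≤-trans (≡⇒≤ (⊗-identityʳ _)) ⊗-dropˡ) ≤-refl)
    (residuation₂ _ _ _ ≤-refl)

  -- Locally u P: any inequality may be proved at u under the assumption P; in terms of
  -- quotients, P holds on a finite family of quotients of L/⟨u⟩ that jointly embeds it.
  Locally : Carrier → (Carrier → Set c) → Set c
  Locally u P = ∀ {s t} → (∀ {v} → v ≼ u → P v → s ⊑[ v ] t) → s ⊑[ u ] t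

  locally≈ : ∀ {u P s t} → Locally u P → (∀ {v} → v ≼ u → P v → s ≈[ v ] t) → s ≈[ u ] t
  locally≈ l k = l (λ e p → to (k e p)) & l (λ e p → from (k e p))

  -- The cases live at `u ⊗ (x ⇒ y)` and `u ⊗ (y ⇒ x)` and return exponents `m` and `n`. The powers
  -- `(x ⇒ y) ^ m` and `(y ⇒ x) ^ n` still have join `𝟙`, and multiplying by this join recombines
  -- both bounds under `u ^ (m + n)`.
  prelinear : ∀ {u} x y → Locally u (λ v → (x ⊑[ v ] y) ⊎ (y ⊑[ v ] x))
  prelinear {u} x y {s} {t} k with k ⊗-≼ (inj₁ (⇒-forced {u} {x} {y})) | k ⊗-≼ (inj₂ (⇒-forced {u} {y} {x}))
  ... | m & p | n & q = (m + n) &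
    ≤-trans (≡⇒≤ (sym (trans (cong (_⊗ (u ^ (m + n) ⊗ s)) (∨≡𝟙-^^ m n (prelinearity x y))) (⊗-identityˡ _))))
      (∨-elim-⊗ (≤-trans (regroup m (^-weakenˡ u m n)) p) (≤-trans (regroup n (^-weakenʳ u m n)) q))
    where
    regroup : ∀ {r} k → (u ^ (m + n)) ≤ (u ^ k) → (r ^ k ⊗ (u ^ (m + n) ⊗ s)) ≤ ((u ⊗ r) ^ k ⊗ s)
    regroup {r} k h = ≤-trans (≡⇒≤ (x∙yz≈y∙xz (r ^ k) (u ^ (m + n)) s))
      (≤-trans (⊗-mono h ≤-refl)
        (≡⇒≤ (trans (sym (⊗-assoc (u ^ k) (r ^ k) s)) (cong (_⊗ s) (sym (×-distrib-+ u r k))))))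

  ⇒-mono : ∀ {u x x' y y'} → x' ⊑[ u ] x → y ⊑[ u ] y' → x ⇒ y ⊑[ u ] x' ⇒ y'
  ⇒-mono p q = ⇒-intro (⊗-mono⊑ ⊑-refl p ⨾ ⇒-elim ⊑-refl ⨾ q)

  ∧-mono : ∀ {u x x' y y'} → x ⊑[ u ] x' → y ⊑[ u ] y' → x ∧ y ⊑[ u ] x' ∧ y'
  ∧-mono p q = ∧-glb (∧ˡ ⨾ p) (∧ʳ ⨾ q)

  ∨-mono : ∀ {u x x' y y'} → x ⊑[ u ] x' → y ⊑[ u ] y' → x ∨ y ⊑[ u ] x' ∨ y'
  ∨-mono p q = ∨-lub (p ⨾ ∨ˡ) (q ⨾ ∨ʳ)

  ¬-anti : ∀ {u x y} → x ⊑[ u ] y → ¬ y ⊑[ u ] ¬ x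
  ¬-anti p = ⇒-mono p ⊑-refl

  ¬¬-mono : ∀ {u x y} → x ⊑[ u ] y → ¬ ¬ x ⊑[ u ] ¬ ¬ y
  ¬¬-mono p = ¬-anti (¬-anti p)

  ⊕-mono : ∀ {u x x' y y'} → x ⊑[ u ] x' → y ⊑[ u ] y' → x ⊕ y ⊑[ u ] x' ⊕ y'
  ⊕-mono p q = ∧-mono (⇒-mono (¬-anti p) q) (⇒-mono (¬-anti q) p)

  ⊕-cong : ∀ {u x x' y y'} → x ≈[ u ] x' → y ≈[ u ] y' → x ⊕ y ≈[ u ] x' ⊕ y'
  ⊕-cong (p & p') (q & q') = ⊕-mono p q & ⊕-mono p' q'

  ⊗-lower : ∀ {u x y} → x ⊗ y ⊑[ u ] x
  ⊗-lower = ≤⇒⊑ ⊗-dropʳ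

  ⊗-lower' : ∀ {u x y} → x ⊗ y ⊑[ u ] y
  ⊗-lower' = ≤⇒⊑ ⊗-dropˡ

  ⇒-eval : ∀ {u x y} → (x ⇒ y) ⊗ x ⊑[ u ] y
  ⇒-eval = ⇒-elim ⊑-refl

  ⇒-weaken : ∀ {u x y} → y ⊑[ u ] x ⇒ y
  ⇒-weaken = ⇒-intro ⊗-lower

  𝟙-⇒ : ∀ {u x} → 𝟙 ⇒ x ⊑[ u ] x
  𝟙-⇒ = ≡⇒⊑ (sym (⊗-identityʳ _)) ⨾ ⇒-eval

  ⊑⇒𝟙⊑ : ∀ {u x y} → x ⊑[ u ] y → 𝟙 ⊑[ u ] x ⇒ y
  ⊑⇒𝟙⊑ p = ⇒-intro (⊗-lower' ⨾ p)

  𝟙⊑⇒⊑ : ∀ {u x y} → 𝟙 ⊑[ u ] x ⇒ y → x ⊑[ u ] y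
  𝟙⊑⇒⊑ p = ≡⇒⊑ (sym (⊗-identityˡ _)) ⨾ ⇒-elim p

  ⇒-swap : ∀ {u x y z} → x ⇒ (y ⇒ z) ⊑[ u ] y ⇒ (x ⇒ z)
  ⇒-swap = ⇒-intro (⇒-intro (≡⇒⊑ (xy∙z≈xz∙y _ _ _) ⨾ ⊗-mono⊑ ⇒-eval ⊑-refl ⨾ ⇒-eval))

  ⇒-curry : ∀ {u x y z} → (x ⊗ y) ⇒ z ⊑[ u ] x ⇒ (y ⇒ z)
  ⇒-curry = ⇒-intro (⇒-intro (≡⇒⊑ (⊗-assoc _ _ _) ⨾ ⇒-eval))

  ⇒-uncurry : ∀ {u x y z} → x ⇒ (y ⇒ z) ⊑[ u ] (x ⊗ y) ⇒ z
  ⇒-uncurry = ⇒-intro (≡⇒⊑ (sym (⊗-assoc _ _ _)) ⨾ ⊗-mono⊑ ⇒-eval ⊑-refl ⨾ ⇒-eval)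

  ⊑¬ : ∀ {u x y} → x ⊗ y ⊑[ u ] 𝟘 → x ⊑[ u ] ¬ y
  ⊑¬ = ⇒-intro

  ⊗¬ : ∀ {u x} → x ⊗ ¬ x ⊑[ u ] 𝟘
  ⊗¬ = ⊗-swap⊑ ⨾ ⇒-eval

  ¬¬-intro : ∀ {u x} → x ⊑[ u ] ¬ ¬ x
  ¬¬-intro = ⊑¬ ⊗¬

  ¬¬¬ : ∀ {u x} → ¬ ¬ ¬ x ⊑[ u ] ¬ x
  ¬¬¬ = ¬-anti ¬¬-intro

  ⊑¬-swap : ∀ {u x y} → x ⊑[ u ] ¬ y → y ⊑[ u ] ¬ x
  ⊑¬-swap p = ¬¬-intro ⨾ ¬-anti p

  ¬𝟘 : ∀ {u x} → x ⊑[ u ] 𝟘 → 𝟙 ⊑[ u ] ¬ x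
  ¬𝟘 = ⊑⇒𝟙⊑

  ¬𝟙 : ∀ {u x} → 𝟙 ⊑[ u ] x → ¬ x ⊑[ u ] 𝟘
  ¬𝟙 p = ¬-anti p ⨾ 𝟙-⇒

  ¬¬𝟘 : ∀ {u x} → x ⊑[ u ] 𝟘 → ¬ ¬ x ⊑[ u ] 𝟘
  ¬¬𝟘 p = ¬𝟙 (¬𝟘 p)

  ⊕-comm : ∀ {u x y} → x ⊕ y ⊑[ u ] y ⊕ x
  ⊕-comm = ∧-glb ∧ʳ ∧ˡ

  ⊕-upperˡ : ∀ {u x y} → x ⊑[ u ] x ⊕ y
  ⊕-upperˡ = ∧-glb (⇒-intro (⊗¬ ⨾ 𝟘-min)) ⇒-weaken

  ⊕-upperʳ : ∀ {u x y} → y ⊑[ u ] x ⊕ y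
  ⊕-upperʳ = ⊕-upperˡ ⨾ ⊕-comm

  ⊕-𝟘ˡ : ∀ {u x y} → x ⊑[ u ] 𝟘 → x ⊕ y ⊑[ u ] y
  ⊕-𝟘ˡ p = ∧ˡ ⨾ ⇒-mono (¬𝟘 p) ⊑-refl ⨾ 𝟙-⇒

  ⊕-𝟘ʳ : ∀ {u x y} → y ⊑[ u ] 𝟘 → x ⊕ y ⊑[ u ] x
  ⊕-𝟘ʳ p = ⊕-comm ⨾ ⊕-𝟘ˡ p

  ⊗-𝟘ˡ : ∀ {u x y} → x ⊑[ u ] 𝟘 → x ⊗ y ⊑[ u ] 𝟘
  ⊗-𝟘ˡ p = ⊗-lower ⨾ p

  ⊗-𝟘ʳ : ∀ {u x y} → y ⊑[ u ] 𝟘 → x ⊗ y ⊑[ u ] 𝟘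
  ⊗-𝟘ʳ p = ⊗-lower' ⨾ p

  ⊗-𝟙ˡ : ∀ {u x y} → 𝟙 ⊑[ u ] x → y ⊑[ u ] x ⊗ y
  ⊗-𝟙ˡ p = ≡⇒⊑ (sym (⊗-identityˡ _)) ⨾ ⊗-mono⊑ p ⊑-refl

  𝟙⊑-⊕ : ∀ {u x y} → ¬ x ⊑[ u ] y → ¬ y ⊑[ u ] x → 𝟙 ⊑[ u ] x ⊕ y
  𝟙⊑-⊕ p q = ∧-glb (⊑⇒𝟙⊑ p) (⊑⇒𝟙⊑ q)

  ⊕-¬ˡ : ∀ {u x y} → 𝟙 ⊑[ u ] x ⊕ y → ¬ x ⊑[ u ] y
  ⊕-¬ˡ p = 𝟙⊑⇒⊑ (p ⨾ ∧ˡ)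

  ⊕-¬ʳ : ∀ {u x y} → 𝟙 ⊑[ u ] x ⊕ y → ¬ y ⊑[ u ] x
  ⊕-¬ʳ p = 𝟙⊑⇒⊑ (p ⨾ ∧ʳ)

  -- MV and dense elements

  MV Dense : Carrier → Carrier → Set c
  MV u x = ¬ ¬ x ⊑[ u ] x
  Dense u x = ¬ x ⊑[ u ] 𝟘

  -- In a chain `x ≤ ¬ y` makes the product vanish; otherwise `¬ y ≤ x` and `¬ x ≤ y`, and both
  -- implications in `x ⊕ y` are `𝟙`. This decides whether adding two last terms produces a further
  -- one.
  ⊕≈𝟙-or-⊗≈𝟘 : ∀ {u} x y → Locally u (λ v → (𝟙 ⊑[ v ] x ⊕ y) ⊎ (x ⊗ y ⊑[ v ] 𝟘))
  ⊕≈𝟙-or-⊗≈𝟘 x y k = prelinear x (¬ y) λ where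
    e (inj₁ p) → k e (inj₂ (⇒-elim p))
    e (inj₂ p) → prelinear y (¬ x) λ where
      f (inj₁ q) → k (≼-trans f e) (inj₂ (⊗-swap⊑ ⨾ ⇒-elim q))
      f (inj₂ q) → k (≼-trans f e) (inj₁ (𝟙⊑-⊕ q (lift f p)))

  -- Writing `y` as `¬ ¬ y` turns the implication into `¬ y ⇒ ¬ x`, where `¬ x` vanishes.
  dense-⇒ : ∀ {u x y} → Dense u x → MV u y → x ⇒ y ⊑[ u ] y
  dense-⇒ d m = ⇒-mono ⊑-refl ¬¬-intro ⨾ ⇒-swap ⨾ ⇒-mono ⊑-refl d ⨾ m

  -- Dense elements act as units on the MV elements below them: in the factorisation
  -- `y = x ⊗ (x ⇒ y)` the second factor is at most `y`.
  MV-⊗-dense : ∀ {u x y} → Dense u x → MV u y → y ⊑[ u ] x → y ⊑[ u ] x ⊗ y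
  MV-⊗-dense d m p = divide p ⨾ ⊗-mono⊑ ⊑-refl (dense-⇒ d m)

  -- In a chain the factor ¬¬x ⇒ x of x = ¬¬x ⊗ (¬¬x ⇒ x) is dense unless x = 0.
  MV-or-dense : ∀ {u} x → Locally u (λ v → MV v x ⊎ Dense v x)
  MV-or-dense {u} x k = prelinear (¬ ¬ x) (¬ d) λ where
      e (inj₁ p) → k e (inj₁ (∧-glb ⊑-refl p ⨾ disjoint ⨾ 𝟘-min))
      e (inj₂ p) → compare e (∧-glb p ⊑-refl ⨾ disjoint)
    where
    d = ¬ ¬ x ⇒ x
    x⊑ : ∀ {v} → x ⊑[ v ] ¬ ¬ x ⊗ d
    x⊑ = divide ¬¬-intro
    -- By divisibility the meet is `¬ ¬ x ⊗ (¬ ¬ x ⇒ ¬ d)`. The second factor is `¬ (¬ ¬ x ⊗ d)`,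
    -- which lies below `¬ x` because `x ⊑ ¬ ¬ x ⊗ d`.
    disjoint : ∀ {v} → ¬ ¬ x ∧ ¬ d ⊑[ v ] 𝟘
    disjoint = ≡⇒⊑ (divisibility _ _) ⨾ ⊗-mono⊑ ⊑-refl (⇒-uncurry ⨾ ¬-anti x⊑) ⨾ ⇒-eval
    compare : ∀ {v} → v ≼ u → Dense v d → _ ⊑[ v ] _
    compare e δ = prelinear (¬ ¬ x) d λ where
      f (inj₁ p) → k (≼-trans f e) (inj₁ (MV-⊗-dense (lift f δ) ¬¬¬ p ⨾ ⇒-eval))
      f (inj₂ p) → k (≼-trans f e) (inj₂ (¬¬-intro ⨾ ¬-anti p ⨾ lift f δ))

  -- This dichotomy gives good sequences over a chain their shape. If `x ⊗ y = 0` and `¬ x ⇒ y ⊑ x`,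
  -- then `y = ¬ x ⊗ (¬ x ⇒ y) ⊑ ¬ x ⊗ x = 0`. If `¬ y ⇒ x` is the smaller implication, an MV
  -- element `x` still satisfies `¬ x ⇒ y ⊑ ¬ y ⇒ x`, and for a dense `x` already `y ⊑ ¬ x = 0`.
  ⊕-idle : ∀ {u} x y → x ⊕ y ⊑[ u ] x → Locally u (λ v → (𝟙 ⊑[ v ] x) ⊎ (y ⊑[ v ] 𝟘))
  ⊕-idle x y h k = ⊕≈𝟙-or-⊗≈𝟘 x y λ where
      e (inj₁ p) → k e (inj₁ (p ⨾ lift e h))
      e (inj₂ p) → prelinear (¬ x ⇒ y) (¬ y ⇒ x) λ where
        f (inj₁ q) → k (≼-trans f e) (inj₂ (vanish (lift f p) (∧-glb ⊑-refl q ⨾ lift (≼-trans f e) h)))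
        f (inj₂ q) → MV-or-dense x λ where
          g (inj₁ m) → let g' = ≼-trans g (≼-trans f e) in k g' (inj₂ (vanish (lift (≼-trans g f) p)
            (⇒-mono ⊑-refl ¬¬-intro ⨾ ⇒-swap ⨾ ⇒-mono ⊑-refl m ⨾ ∧-glb (lift g q) ⊑-refl ⨾ lift g' h)))
          g (inj₂ δ) → k (≼-trans g (≼-trans f e)) (inj₂ (⊑¬-swap (⊑¬ (lift (≼-trans g f) p)) ⨾ δ))
    where
    vanish : ∀ {v} → x ⊗ y ⊑[ v ] 𝟘 → ¬ x ⇒ y ⊑[ v ] x → y ⊑[ v ] 𝟘
    vanish p q = divide (⊑¬-swap (⊑¬ p)) ⨾ ⊗-mono⊑ ⊑-refl q ⨾ ⇒-eval

  -- First of the laws that make `¬ ¬` a homomorphism. Forwards, a dense factor has double negation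
  -- `𝟙` and may be dropped; for two MV factors the product is MV, or it is dense and then so are
  -- both factors.
  ¬¬-⊗ : ∀ {u x y} → ¬ ¬ (x ⊗ y) ≈[ u ] ¬ ¬ x ⊗ ¬ ¬ y
  ¬¬-⊗ {u} {x} {y} = forth & back
    where
    absorb : ∀ {v x y} → Dense v x → ¬ ¬ (x ⊗ y) ⊑[ v ] ¬ ¬ x ⊗ ¬ ¬ y
    absorb δ = ¬¬-mono ⊗-lower' ⨾ ⊗-𝟙ˡ (¬𝟘 δ)
    forth : ¬ ¬ (x ⊗ y) ⊑[ u ] ¬ ¬ x ⊗ ¬ ¬ y
    forth = MV-or-dense x λ where
      e (inj₂ δ) → absorb δ
      e (inj₁ m) → MV-or-dense y λ where
        f (inj₂ δ) → ¬¬-mono ⊗-swap⊑ ⨾ absorb δ ⨾ ⊗-swap⊑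
        f (inj₁ n) → MV-or-dense (x ⊗ y) λ where
          g (inj₁ o) → o ⨾ ⊗-mono⊑ ¬¬-intro ¬¬-intro
          g (inj₂ δ) → 𝟙-max ⨾ ⊗-𝟙ˡ (¬𝟘 (¬-anti ⊗-lower ⨾ δ)) ⨾ ⊗-mono⊑ ⊑-refl (¬𝟘 (¬-anti ⊗-lower' ⨾ δ))
    back : ¬ ¬ x ⊗ ¬ ¬ y ⊑[ u ] ¬ ¬ (x ⊗ y)
    back = ⊑¬ (⊗-swap⊑ ⨾ ≡⇒⊑ (sym (⊗-assoc _ _ _)) ⨾ ⊗-mono⊑ refute ⊑-refl ⨾ ⊗¬)
      where
      refute : ¬ (x ⊗ y) ⊗ ¬ ¬ x ⊑[ u ] ¬ y
      refute = ⊑¬ (≡⇒⊑ (xy∙z≈xz∙y _ _ _)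
        ⨾ ⊗-mono⊑ (⊗-mono⊑ (¬-anti ⊗-swap⊑ ⨾ ⇒-curry) ⊑-refl ⨾ ⇒-eval) ⊑-refl ⨾ ⊗¬)

  ¬¬-∧ : ∀ {u x y} → ¬ ¬ (x ∧ y) ≈[ u ] ¬ ¬ x ∧ ¬ ¬ y
  ¬¬-∧ {u} {x} {y} = ∧-glb (¬¬-mono ∧ˡ) (¬¬-mono ∧ʳ) & prelinear x y λ where
    e (inj₁ p) → ∧ˡ ⨾ ¬¬-mono (∧-glb ⊑-refl p)
    e (inj₂ p) → ∧ʳ ⨾ ¬¬-mono (∧-glb p ⊑-refl)

  ¬¬-∨ : ∀ {u x y} → ¬ ¬ (x ∨ y) ≈[ u ] ¬ ¬ x ∨ ¬ ¬ y
  ¬¬-∨ {u} {x} {y} = (prelinear x y λ where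
    e (inj₁ p) → ¬¬-mono (∨-lub p ⊑-refl) ⨾ ∨ʳ
    e (inj₂ p) → ¬¬-mono (∨-lub ⊑-refl p) ⨾ ∨ˡ) & ∨-lub (¬¬-mono ∨ˡ) (¬¬-mono ∨ʳ)

  -- For the reverse inequality, a dense `y` makes the larger `x ⇒ y` dense, and an MV `y` absorbs
  -- its own double negation.
  ¬¬-⇒ : ∀ {u x y} → ¬ ¬ (x ⇒ y) ≈[ u ] x ⇒ ¬ ¬ y
  ¬¬-⇒ {u} {x} {y} = forth & back
    where
    forth : ¬ ¬ (x ⇒ y) ⊑[ u ] x ⇒ ¬ ¬ y
    forth = ¬-anti (⊑¬ (≡⇒⊑ (xy∙z≈xz∙y _ _ _) ⨾ ⊗-mono⊑ (⊗-swap⊑ ⨾ ⇒-eval) ⊑-refl ⨾ ⊗¬)) ⨾ ⇒-curry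
    back : x ⇒ ¬ ¬ y ⊑[ u ] ¬ ¬ (x ⇒ y)
    back = MV-or-dense y λ where
      e (inj₁ m) → ⇒-mono ⊑-refl m ⨾ ¬¬-intro
      e (inj₂ δ) → 𝟙-max ⨾ ¬𝟘 (¬-anti ⇒-weaken ⨾ δ)

  ¬¬-⊕ : ∀ {u x y} → ¬ ¬ (x ⊕ y) ≈[ u ] ¬ ¬ x ⊕ ¬ ¬ y
  ¬¬-⊕ = ≈-trans ¬¬-∧ ((∧-mono half half) & (∧-mono half' half'))
    where
    half : ∀ {u x y} → ¬ ¬ (¬ x ⇒ y) ⊑[ u ] ¬ (¬ (¬ x)) ⇒ ¬ ¬ y
    half = to ¬¬-⇒ ⨾ ⇒-mono ¬¬¬ ⊑-refl
    half' : ∀ {u x y} → ¬ (¬ (¬ x)) ⇒ ¬ ¬ y ⊑[ u ] ¬ ¬ (¬ x ⇒ y)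
    half' = ⇒-mono ¬¬-intro ⊑-refl ⨾ from ¬¬-⇒

  -- When three sequences with last terms `x`, `y`, `z` are added, this is the second of the three
  -- terms after the common block of ones; see `ones-sum₃`.
  carry : Carrier → Carrier → Carrier → Carrier
  carry x y z = (x ⊗ y) ⊕ ((x ⊕ y) ⊗ z)

  MV-⊕ : ∀ {u x y} → MV u x → ¬ x ⇒ y ⊑[ u ] x ⊕ y
  MV-⊕ m = ∧-glb ⊑-refl (⇒-mono ⊑-refl ¬¬-intro ⨾ ⇒-swap ⨾ ⇒-mono ⊑-refl m)

  MV-⊗-closed : ∀ {u x y} → MV u x → MV u y → MV u (x ⊗ y)
  MV-⊗-closed m n = to ¬¬-⊗ ⨾ ⊗-mono⊑ m n

  MV-⊕-closed : ∀ {u x y} → MV u x → MV u y → MV u (x ⊕ y)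
  MV-⊕-closed m n = to ¬¬-⊕ ⨾ ⊕-mono m n

  MV-⊕-assoc : ∀ {u x y z} → MV u x → MV u y → MV u z → x ⊕ (y ⊕ z) ⊑[ u ] (x ⊕ y) ⊕ z
  MV-⊕-assoc m n o = ∧ˡ ⨾ ⇒-mono ⊑-refl ∧ʳ ⨾ ⇒-swap ⨾ ⇒-mono ⊑-refl (MV-⊕ m) ⨾ MV-⊕ o ⨾ ⊕-comm

  -- Cancellation of an MV factor: `¬ y ⊑ x`, so divisibility gives `¬ y ⊑ x ⊗ ¬ (x ⊗ y)`, and this
  -- is negated.
  MV-⇒-⊗ : ∀ {u x y} → MV u x → MV u y → ¬ x ⊑[ u ] y → x ⇒ (x ⊗ y) ⊑[ u ] y
  MV-⇒-⊗ m n p = ⇒-mono ⊑-refl ¬¬-intro ⨾ ⇒-uncurry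
    ⨾ ¬-anti (divide (¬-anti p ⨾ m) ⨾ ⊗-mono⊑ ⊑-refl ⇒-uncurry) ⨾ n

  -- In a Łukasiewicz chain the hypotheses make both sides equal to x + y + z - 1. Algebraically
  -- `y = ¬ z ⊗ (¬ z ⇒ y)` lets a factor `¬ z` be pulled out of `x ⊗ y` and cancelled by `MV-⇒-⊗`.
  MV-shiftʳ : ∀ {u x y z} → MV u x → MV u y → MV u z → 𝟙 ⊑[ u ] x ⊕ y → y ⊗ z ⊑[ u ] 𝟘 →
              (x ⊗ y) ⊕ z ⊑[ u ] x ⊗ (y ⊕ z)
  MV-shiftʳ {u} {x} {y} {z} l m n p q =
      ∧ʳ ⨾ ⇒-mono ⊑-refl expand ⨾ MV-⇒-⊗ ¬¬¬ (MV-⊗-closed l (MV-⊕-closed m n)) (¬¬-mono z⊑ ⨾ MV-⊗-closed l (MV-⊕-closed m n))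
    where
    y⊑¬z : y ⊑[ u ] ¬ z
    y⊑¬z = ⊑¬ q
    expand : x ⊗ y ⊑[ u ] ¬ z ⊗ (x ⊗ (y ⊕ z))
    expand = ⊗-mono⊑ ⊑-refl (divide y⊑¬z ⨾ ⊗-mono⊑ ⊑-refl (MV-⊕ n ⨾ ⊕-comm)) ⨾ ≡⇒⊑ (x∙yz≈y∙xz _ _ _)
    ¬⊕ : ¬ (y ⊕ z) ⊑[ u ] ¬ y ⊗ ¬ z
    ¬⊕ = ¬-anti (⇒-curry ⨾ ⇒-mono ⊑-refl n ⨾ MV-⊕ m) ⨾ MV-⊗-closed ¬¬¬ ¬¬¬
    z⊑ : z ⊑[ u ] x ⊗ (y ⊕ z)
    z⊑ = ⊑¬-swap (⇒-curry ⨾ ⇒-mono (⊕-¬ʳ p) ¬⊕ ⨾ MV-⇒-⊗ ¬¬¬ ¬¬¬ (m ⨾ y⊑¬z)) ⨾ MV-⊗-closed l (MV-⊕-closed m n)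

  MV-shiftˡ : ∀ {u x y z} → MV u z → x ⊗ (y ⊕ z) ⊑[ u ] (x ⊗ y) ⊕ z
  MV-shiftˡ n = ⊗-mono⊑ ⊑-refl ∧ʳ ⨾ ⇒-intro (≡⇒⊑ (⊗-assoc _ _ _) ⨾ ⊗-mono⊑ ⊑-refl ⇒-eval) ⨾ MV-⊕ n ⨾ ⊕-comm

  MV-shift-⊕ : ∀ {u x y z} → MV u x → MV u z → 𝟙 ⊑[ u ] x ⊕ y → (x ⊗ y) ⊕ z ⊑[ u ] x ⊕ (y ⊗ z)
  MV-shift-⊕ {u} {x} {y} {z} l n p = ⇒-intro (⊗-mono⊑ ∧ʳ (divide (⊕-¬ˡ p) ⨾ ⊗-swap⊑ ⨾ ⊗-mono⊑ (⇒-uncurry ⨾ ¬-anti ⊗-swap⊑) ⊑-refl)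
      ⨾ ≡⇒⊑ (sym (⊗-assoc _ _ _)) ⨾ ⊗-mono⊑ (⊗-mono⊑ contrapose ⊑-refl ⨾ ⇒-eval ⨾ n) ⊑-refl ⨾ ⊗-swap⊑) ⨾ MV-⊕ l
    where
    contrapose : ¬ z ⇒ (x ⊗ y) ⊑[ u ] ¬ (x ⊗ y) ⇒ ¬ ¬ z
    contrapose = ⇒-mono ⊑-refl ¬¬-intro ⨾ ⇒-swap

  MV-shift-⊗ : ∀ {u x y z} → MV u y → y ⊗ z ⊑[ u ] 𝟘 → (x ⊕ y) ⊗ z ⊑[ u ] x ⊗ (y ⊕ z)
  MV-shift-⊗ m q = ⊗-mono⊑ ∧ʳ (divide (⊑¬-swap (⊑¬ q))) ⨾ ≡⇒⊑ (sym (⊗-assoc _ _ _))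
    ⨾ ⊗-mono⊑ ⇒-eval (MV-⊕ m)

  -- In a Łukasiewicz chain `carry x y z` is x + y + z - 1 truncated to the unit interval, hence
  -- symmetric. Once it is decided whether `x`, `y` and `y`, `z` overflow, both carries simplify and
  -- a shift lemma compares them.
  MV-carry : ∀ {u x y z} → MV u x → MV u y → MV u z → carry x y z ⊑[ u ] carry y z x
  MV-carry {x = x} {y} {z} l m n = ⊕≈𝟙-or-⊗≈𝟘 x y λ where
    e (inj₁ p) → ⊕-mono ⊑-refl ⊗-lower' ⨾ (⊕≈𝟙-or-⊗≈𝟘 y z λ where
      f (inj₁ q) → let g = ≼-trans f e in
        MV-shift-⊕ (lift g l) (lift g n) (lift f p) ⨾ ⊕-comm ⨾ ⊕-mono ⊑-refl (⊗-𝟙ˡ q)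
      f (inj₂ q) → let g = ≼-trans f e in
        MV-shiftʳ (lift g l) (lift g m) (lift g n) (lift f p) q ⨾ ⊗-swap⊑ ⨾ ⊕-upperʳ)
    e (inj₂ p) → ⊕-𝟘ˡ p ⨾ (⊕≈𝟙-or-⊗≈𝟘 y z λ where
      f (inj₁ q) → ⊗-swap⊑ ⨾ ⊗-mono⊑ ⊑-refl ⊕-comm ⨾ MV-shiftˡ (lift (≼-trans f e) l)
        ⨾ ⊕-mono ⊗-swap⊑ (⊗-𝟙ˡ q)
      f (inj₂ q) → MV-shift-⊗ (lift (≼-trans f e) m) q ⨾ ⊗-swap⊑ ⨾ ⊕-upperʳ)

  -- Crisp elements: those that are 0 or dense in each chain.

  Crisp : Carrier → Carrier → Set c
  Crisp u x = x ∧ ¬ x ⊑[ u ] 𝟘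

  crisp-𝟘 : ∀ {u x} → x ⊑[ u ] 𝟘 → Crisp u x
  crisp-𝟘 p = ∧ˡ ⨾ p

  crisp-dense : ∀ {u x} → Dense u x → Crisp u x
  crisp-dense p = ∧ʳ ⨾ p

  -- Whichever of `x` and `¬ x` is the smaller equals their meet and vanishes.
  crisp-cases : ∀ {u} x → Crisp u x → Locally u (λ v → (x ⊑[ v ] 𝟘) ⊎ Dense v x)
  crisp-cases x h k = prelinear x (¬ x) λ where
    e (inj₁ p) → k e (inj₁ (∧-glb ⊑-refl p ⨾ lift e h))
    e (inj₂ p) → k e (inj₂ (∧-glb p ⊑-refl ⨾ lift e h))

  dense-mono : ∀ {u x y} → Dense u x → x ⊑[ u ] y → Dense u y
  dense-mono δ p = ¬-anti p ⨾ δ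

  dense-⊗ : ∀ {u x y} → Dense u x → Dense u y → Dense u (x ⊗ y)
  dense-⊗ δ ε = ⇒-curry ⨾ ⇒-mono ⊑-refl ε ⨾ δ

  dense-∧ : ∀ {u x y} → Dense u x → Dense u y → Dense u (x ∧ y)
  dense-∧ δ ε = dense-mono (dense-⊗ δ ε) (∧-glb ⊗-lower ⊗-lower')

  dense-⊕ : ∀ {u x y} → Dense u x → Dense u y → 𝟙 ⊑[ u ] x ⊕ y
  dense-⊕ δ ε = 𝟙⊑-⊕ (δ ⨾ 𝟘-min) (ε ⨾ 𝟘-min)

  crisp-op : (_∙_ : Carrier → Carrier → Carrier) →
             (∀ {u x y} → x ⊑[ u ] 𝟘 → Crisp u y → Crisp u (x ∙ y)) →
             (∀ {u x y} → y ⊑[ u ] 𝟘 → Crisp u x → Crisp u (x ∙ y)) →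
             (∀ {u x y} → Dense u x → Dense u y → Dense u (x ∙ y)) →
             ∀ {u x y} → Crisp u x → Crisp u y → Crisp u (x ∙ y)
  crisp-op _ zeroˡ zeroʳ dense {x = x} {y} p q = crisp-cases x p λ where
    e (inj₁ o) → zeroˡ o (lift e q)
    e (inj₂ δ) → crisp-cases y (lift e q) λ where
      f (inj₁ o) → zeroʳ o (crisp-dense (lift f δ))
      f (inj₂ ε) → crisp-dense (dense (lift f δ) ε)

  crisp-cong : ∀ {u x y} → x ≈[ u ] y → Crisp u x → Crisp u y
  crisp-cong (p & q) h = ∧-mono q (¬-anti p) ⨾ h

  crisp-⊗ : ∀ {u x y} → Crisp u x → Crisp u y → Crisp u (x ⊗ y)
  crisp-⊗ = crisp-op _⊗_ (λ o _ → crisp-𝟘 (⊗-𝟘ˡ o)) (λ o _ → crisp-𝟘 (⊗-𝟘ʳ o)) dense-⊗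

  crisp-⊕ : ∀ {u x y} → Crisp u x → Crisp u y → Crisp u (x ⊕ y)
  crisp-⊕ = crisp-op _⊕_ (λ o → crisp-cong (⊕-upperʳ & ⊕-𝟘ˡ o)) (λ o → crisp-cong (⊕-upperˡ & ⊕-𝟘ʳ o))
    (λ δ _ → dense-mono δ ⊕-upperˡ)

  crisp-∧ : ∀ {u x y} → Crisp u x → Crisp u y → Crisp u (x ∧ y)
  crisp-∧ = crisp-op _∧_ (λ o _ → crisp-𝟘 (∧ˡ ⨾ o)) (λ o _ → crisp-𝟘 (∧ʳ ⨾ o)) dense-∧

  crisp-∨ : ∀ {u x y} → Crisp u x → Crisp u y → Crisp u (x ∨ y)
  crisp-∨ = crisp-op _∨_ (λ o → crisp-cong (∨ʳ & ∨-lub (o ⨾ 𝟘-min) ⊑-refl))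
    (λ o → crisp-cong (∨ˡ & ∨-lub ⊑-refl (o ⨾ 𝟘-min))) (λ δ _ → dense-mono δ ∨ˡ)

  -- Two dense summands already give `𝟙`; a summand 0 drops out.
  crisp-⊕-assoc : ∀ {u x y z} → Crisp u x → Crisp u y → Crisp u z → x ⊕ (y ⊕ z) ⊑[ u ] (x ⊕ y) ⊕ z
  crisp-⊕-assoc {x = x} {y} p q _ = crisp-cases x p λ where
    e (inj₁ o) → ⊕-𝟘ˡ o ⨾ ⊕-mono ⊕-upperʳ ⊑-refl
    e (inj₂ δ) → crisp-cases y (lift e q) λ where
      f (inj₁ o) → ⊕-mono ⊕-upperˡ (⊕-𝟘ˡ o)
      f (inj₂ ε) → 𝟙-max ⨾ dense-⊕ (lift f δ) ε ⨾ ⊕-upperˡ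

  crisp-carry : ∀ {u x y z} → Crisp u x → Crisp u y → Crisp u z → carry x y z ⊑[ u ] carry y z x
  crisp-carry {x = x} {y} {z} p q r = crisp-cases x p λ where
    e (inj₁ o) → ⊕-𝟘ˡ (⊗-𝟘ˡ o) ⨾ ⊗-mono⊑ (⊕-𝟘ˡ o) ⊑-refl ⨾ ⊕-upperˡ
    e (inj₂ δ) → crisp-cases y (lift e q) λ where
      f (inj₁ o) → ⊕-𝟘ˡ (⊗-𝟘ʳ o) ⨾ ⊗-mono⊑ (⊕-𝟘ʳ o) ⊕-upperʳ ⨾ ⊗-swap⊑ ⨾ ⊕-upperʳ
      f (inj₂ ε) → crisp-cases z (lift (≼-trans f e) r) λ where
        g (inj₁ o) → ⊕-𝟘ʳ (⊗-𝟘ʳ o) ⨾ ⊗-swap⊑ ⨾ ⊗-mono⊑ ⊕-upperˡ ⊑-refl ⨾ ⊕-upperʳ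
        g (inj₂ ζ) → 𝟙-max ⨾ dense-⊕ (dense-⊗ (lift g ε) ζ)
          (dense-⊗ (dense-mono (lift g ε) ⊕-upperˡ) (lift (≼-trans g f) δ))

  -- A class of elements, given at u by an inequality lower x ⊑[ u ] upper x, on which the
  -- sum of good sequences is associative.
  record Class : Set c where
    field
      lower upper : Carrier → Carrier
    Member : Carrier → Carrier → Set c
    Member u x = lower x ⊑[ u ] upper x
    field
      𝟘-member : ∀ {u} → Member u 𝟘
      ⊕-closed : ∀ {u x y} → Member u x → Member u y → Member u (x ⊕ y)
      ⊗-closed : ∀ {u x y} → Member u x → Member u y → Member u (x ⊗ y)
      ∧-closed : ∀ {u x y} → Member u x → Member u y → Member u (x ∧ y)
      ∨-closed : ∀ {u x y} → Member u x → Member u y → Member u (x ∨ y)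
      ⊕-assoc : ∀ {u x y z} → Member u x → Member u y → Member u z → x ⊕ (y ⊕ z) ⊑[ u ] (x ⊕ y) ⊕ z
      carry-rotate : ∀ {u x y z} → Member u x → Member u y → Member u z → carry x y z ⊑[ u ] carry y z x

  mvClass : Class
  mvClass = record
    { lower = λ x → ¬ ¬ x ; upper = λ x → x
    ; 𝟘-member = ¬¬𝟘 ⊑-refl
    ; ⊕-closed = MV-⊕-closed ; ⊗-closed = MV-⊗-closed
    ; ∧-closed = λ m n → to ¬¬-∧ ⨾ ∧-mono m n
    ; ∨-closed = λ m n → to ¬¬-∨ ⨾ ∨-mono m n
    ; ⊕-assoc = MV-⊕-assoc ; carry-rotate = MV-carry
    }

  crispClass : Class
  crispClass = record
    { lower = λ x → x ∧ ¬ x ; upper = λ _ → 𝟘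
    ; 𝟘-member = ∧ˡ
    ; ⊕-closed = crisp-⊕ ; ⊗-closed = crisp-⊗ ; ∧-closed = crisp-∧ ; ∨-closed = crisp-∨
    ; ⊕-assoc = crisp-⊕-assoc ; carry-rotate = crisp-carry
    }

-- Sequences and their sums modulo a filter.

module Sequences {c : Level} (L : BLAlgebra c) where
  open BLAlgebra L
  open ChangGroup L
  open Order L

  infixr 7 _∷ₛ_
  _∷ₛ_ : Carrier → Seq → Seq
  (x ∷ₛ s) zero = x
  (x ∷ₛ s) (suc i) = s i

  single : Carrier → Seq
  single x = x ∷ₛ 0ₛ

  ones : ℕ → Seq → Seq
  ones zero s = s
  ones (suc n) s = 𝟙 ∷ₛ ones n s

  infix 2 _⊑ₛ[_]_ _≈ₛ[_]_
  record _⊑ₛ[_]_ (a : Seq) (u : Carrier) (b : Seq) : Set c where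
    constructor pointwise
    field
      at : ∀ i → a i ⊑[ u ] b i
  open _⊑ₛ[_]_ public

  record _≈ₛ[_]_ (a : Seq) (u : Carrier) (b : Seq) : Set c where
    constructor pointwise
    field
      at≈ : ∀ i → a i ≈[ u ] b i
  open _≈ₛ[_]_ public

  ≈ₛ-refl : ∀ {u a} → a ≈ₛ[ u ] a
  ≈ₛ-refl = pointwise λ i → ≈-refl

  ≈ₛ-sym : ∀ {u a b} → a ≈ₛ[ u ] b → b ≈ₛ[ u ] a
  ≈ₛ-sym p = pointwise λ i → ≈-sym (at≈ p i)

  ≈ₛ-trans : ∀ {u a b d} → a ≈ₛ[ u ] b → b ≈ₛ[ u ] d → a ≈ₛ[ u ] d
  ≈ₛ-trans p q = pointwise λ i → ≈-trans (at≈ p i) (at≈ q i)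

  ≈ₛ⇒⊑ₛ : ∀ {u a b} → a ≈ₛ[ u ] b → a ⊑ₛ[ u ] b
  ≈ₛ⇒⊑ₛ p = pointwise λ i → to (at≈ p i)

  ⊑ₛ-refl : ∀ {u a} → a ⊑ₛ[ u ] a
  ⊑ₛ-refl = pointwise λ i → ⊑-refl

  ⊑ₛ-antisym : ∀ {u a b} → a ⊑ₛ[ u ] b → b ⊑ₛ[ u ] a → a ≈ₛ[ u ] b
  ⊑ₛ-antisym p q = pointwise λ i → at p i & at q i

  ⊑ₛ-trans : ∀ {u a b d} → a ⊑ₛ[ u ] b → b ⊑ₛ[ u ] d → a ⊑ₛ[ u ] d
  ⊑ₛ-trans p q = pointwise λ i → at p i ⨾ at q i

  ≐⇒≈ₛ : ∀ {u a b} → a ≐ b → a ≈ₛ[ u ] b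
  ≐⇒≈ₛ p = pointwise λ i → ≡⇒≈ (p i)

  lift⊑ₛ : ∀ {u v a b} → v ≼ u → a ⊑ₛ[ u ] b → a ⊑ₛ[ v ] b
  lift⊑ₛ e p = pointwise λ i → lift e (at p i)

  lift≈ₛ : ∀ {u v a b} → v ≼ u → a ≈ₛ[ u ] b → a ≈ₛ[ v ] b
  lift≈ₛ e p = pointwise λ i → lift≈ e (at≈ p i)

  locally⊑ₛ : ∀ {u P a b} → Locally u P → (∀ {v} → v ≼ u → P v → a ⊑ₛ[ v ] b) → a ⊑ₛ[ u ] b
  locally⊑ₛ l k = pointwise λ i → l (λ e p → at (k e p) i)

  locally≈ₛ : ∀ {u P a b} → Locally u P → (∀ {v} → v ≼ u → P v → a ≈ₛ[ v ] b) → a ≈ₛ[ u ] b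
  locally≈ₛ l k = pointwise λ i → locally≈ l (λ e p → at≈ (k e p) i)

  ∷ₛ-cong : ∀ {u x y a b} → x ≈[ u ] y → a ≈ₛ[ u ] b → x ∷ₛ a ≈ₛ[ u ] y ∷ₛ b
  ∷ₛ-cong p q = pointwise λ where
    zero → p
    (suc i) → at≈ q i

  ∷ₛ-mono : ∀ {u x y a b} → x ⊑[ u ] y → a ⊑ₛ[ u ] b → x ∷ₛ a ⊑ₛ[ u ] y ∷ₛ b
  ∷ₛ-mono p q = pointwise λ where
    zero → p
    (suc i) → at q i

  single-cong : ∀ {u x y} → x ≈[ u ] y → single x ≈ₛ[ u ] single y
  single-cong p = ∷ₛ-cong p ≈ₛ-refl

  ones-cong : ∀ {u a b} n → a ≈ₛ[ u ] b → ones n a ≈ₛ[ u ] ones n b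
  ones-cong zero p = p
  ones-cong (suc n) p = ∷ₛ-cong ≈-refl (ones-cong n p)

  ones-mono : ∀ {u a b} n → a ⊑ₛ[ u ] b → ones n a ⊑ₛ[ u ] ones n b
  ones-mono zero p = p
  ones-mono (suc n) p = ∷ₛ-mono ⊑-refl (ones-mono n p)

  ones-cancel : ∀ {u a b} n → ones n a ⊑ₛ[ u ] ones n b → a ⊑ₛ[ u ] b
  ones-cancel zero p = p
  ones-cancel (suc n) p = ones-cancel n (pointwise λ i → at p (suc i))

  ones-≡ : ∀ {u a m n} → m ≡ n → ones m a ≈ₛ[ u ] ones n a
  ones-≡ refl = ≈ₛ-refl

  ones-+ : ∀ {u a} m n → ones m (ones n a) ≈ₛ[ u ] ones (m + n) a
  ones-+ zero n = ≈ₛ-refl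
  ones-+ (suc m) n = ∷ₛ-cong ≈-refl (ones-+ m n)

  ones-∷ : ∀ {u a} n → ones n (𝟙 ∷ₛ a) ≈ₛ[ u ] ones (suc n) a
  ones-∷ zero = ≈ₛ-refl
  ones-∷ (suc n) = ∷ₛ-cong ≈-refl (ones-∷ n)

  partialSum-mono : ∀ {u a a' b b'} n j → a ⊑ₛ[ u ] a' → b ⊑ₛ[ u ] b' →
                    partialSum a b n j ⊑[ u ] partialSum a' b' n j
  partialSum-mono n zero p q = at p n
  partialSum-mono n (suc j) p q = ⊕-mono (partialSum-mono n j p q) (⊗-mono⊑ (at p (n ∸ suc j)) (at q j))

  +ₛ-mono : ∀ {u a a' b b'} → a ⊑ₛ[ u ] a' → b ⊑ₛ[ u ] b' → a +ₛ b ⊑ₛ[ u ] a' +ₛ b'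
  +ₛ-mono p q = pointwise λ n → ⊕-mono (partialSum-mono n n p q) (at q n)

  +ₛ-cong : ∀ {u a a' b b'} → a ≈ₛ[ u ] a' → b ≈ₛ[ u ] b' → a +ₛ b ≈ₛ[ u ] a' +ₛ b'
  +ₛ-cong p q = ⊑ₛ-antisym (+ₛ-mono (≈ₛ⇒⊑ₛ p) (≈ₛ⇒⊑ₛ q)) (+ₛ-mono (≈ₛ⇒⊑ₛ (≈ₛ-sym p)) (≈ₛ⇒⊑ₛ (≈ₛ-sym q)))

  𝟙⊕ : ∀ x → (𝟙 ⊕ x) ≡ 𝟙
  𝟙⊕ x = ≈⇒≡ (𝟙-max & ⊕-upperˡ)

  ⊕𝟙 : ∀ x → (x ⊕ 𝟙) ≡ 𝟙
  ⊕𝟙 x = ≈⇒≡ (𝟙-max & ⊕-upperʳ)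

  𝟘⊕ : ∀ x → (𝟘 ⊕ x) ≡ x
  𝟘⊕ x = ≈⇒≡ (⊕-𝟘ˡ ⊑-refl & ⊕-upperʳ)

  ⊕𝟘 : ∀ x → (x ⊕ 𝟘) ≡ x
  ⊕𝟘 x = ≈⇒≡ (⊕-𝟘ʳ ⊑-refl & ⊕-upperˡ)

  𝟘⊗ : ∀ x → 𝟘 ⊗ x ≡ 𝟘
  𝟘⊗ x = ≈⇒≡ (⊗-lower & 𝟘-min)

  ⊗𝟘≡ : ∀ x → x ⊗ 𝟘 ≡ 𝟘
  ⊗𝟘≡ x = ≈⇒≡ (⊗-lower' & 𝟘-min)

  partialSum-𝟙∷ : ∀ a b k j → j ≤ℕ k → partialSum (𝟙 ∷ₛ a) b (suc k) j ≡ partialSum a b k j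
  partialSum-𝟙∷ a b k zero _ = refl
  partialSum-𝟙∷ a b (suc k) (suc j) (s≤s j≤k) =
    cong₂ _⊕_ (partialSum-𝟙∷ a b (suc k) j (m≤n⇒m≤1+n j≤k))
              -- The bound on `j` keeps the truncated difference positive, so that the index reaches
              -- the tail `a` and not the leading `𝟙`.
              (cong (λ i → (𝟙 ∷ₛ a) i ⊗ b j) (+-∸-assoc 1 j≤k))

  -- The leading `𝟙` contributes `𝟙 ⊗ b k`, exactly the last summand of `(a +ₛ b) k`; the term
  -- `b (suc k)` is left over.
  𝟙∷-+ₛ-suc : ∀ a b k → ((𝟙 ∷ₛ a) +ₛ b) (suc k) ≡ ((a +ₛ b) k ⊕ b (suc k))
  𝟙∷-+ₛ-suc a b k = cong (_⊕ b (suc k)) (cong₂ _⊕_ (partialSum-𝟙∷ a b k k ≤ℕ-refl)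
    (trans (cong (λ i → (𝟙 ∷ₛ a) i ⊗ b k) (n∸n≡0 k)) (⊗-identityˡ (b k))))

  -- Disposes of that leftover: the next entry is 0 unless the present entry is `𝟙`, which already
  -- saturates the sum.
  ones-idle : ∀ m y s k → ((s ⊕ ones m (single y) k) ⊕ ones m (single y) (suc k)) ≡ (s ⊕ ones m (single y) k)
  ones-idle zero y s zero = ⊕𝟘 _
  ones-idle zero y s (suc k) = ⊕𝟘 _
  ones-idle (suc m) y s zero = trans (cong (_⊕ ones m (single y) 0) (⊕𝟙 s)) (trans (𝟙⊕ _) (sym (⊕𝟙 s)))
  ones-idle (suc m) y s (suc k) = ones-idle m y s k

  partialSum-single : ∀ x b k j → j ≤ℕ k → partialSum (single x) b (suc k) j ≡ 𝟘
  partialSum-single x b k zero _ = refl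
  partialSum-single x b (suc k) (suc j) (s≤s j≤k) =
    trans (cong₂ _⊕_ (partialSum-single x b (suc k) j (m≤n⇒m≤1+n j≤k))
            (trans (cong (λ i → single x i ⊗ b j) (+-∸-assoc 1 j≤k)) (𝟘⊗ (b j))))
          (𝟘⊕ 𝟘)

  single-+ₛ-suc : ∀ x b k → (single x +ₛ b) (suc k) ≡ ((x ⊗ b k) ⊕ b (suc k))
  single-+ₛ-suc x b k = cong (_⊕ b (suc k)) (trans (cong₂ _⊕_ (partialSum-single x b k k ≤ℕ-refl)
    (cong (λ i → single x i ⊗ b k) (n∸n≡0 k))) (𝟘⊕ _))

  single-+ₛ-ones : ∀ m x y → single x +ₛ ones m (single y) ≐ ones m ((x ⊕ y) ∷ₛ single (x ⊗ y))
  single-+ₛ-ones zero x y zero = refl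
  single-+ₛ-ones zero x y (suc zero) = trans (single-+ₛ-suc x (single y) 0) (⊕𝟘 _)
  single-+ₛ-ones zero x y (suc (suc k)) =
    trans (single-+ₛ-suc x (single y) (suc k)) (trans (⊕𝟘 _) (⊗𝟘≡ x))
  single-+ₛ-ones (suc m) x y zero = ⊕𝟙 x
  single-+ₛ-ones (suc m) x y (suc zero) =
    trans (single-+ₛ-suc x (ones (suc m) (single y)) 0)
      (trans (cong (_⊕ ones m (single y) 0) (⊗-identityʳ x)) (single-+ₛ-ones m x y 0))
  single-+ₛ-ones (suc m) x y (suc (suc k)) =
    trans (single-+ₛ-suc x (ones (suc m) (single y)) (suc k))
      (trans (sym (single-+ₛ-suc x (ones m (single y)) k)) (single-+ₛ-ones m x y (suc k)))

  -- The formula behind every computation of a sum: each leading one shifts the shorter sum by one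
  -- place, by `𝟙∷-+ₛ-suc` and `ones-idle`.
  ones-+ₛ-ones : ∀ n m x y →
    ones n (single x) +ₛ ones m (single y) ≐ ones (n + m) ((x ⊕ y) ∷ₛ single (x ⊗ y))
  ones-+ₛ-ones zero m x y i = single-+ₛ-ones m x y i
  ones-+ₛ-ones (suc n) m x y zero = 𝟙⊕ _
  ones-+ₛ-ones (suc n) m x y (suc k) = trans (𝟙∷-+ₛ-suc (ones n (single x)) (ones m (single y)) k)
    (trans (ones-idle m y _ k) (ones-+ₛ-ones n m x y k))

  -- Good sequences

  -- `IsGood` relative to a filter. The inequality converse to `step` always holds, by `⊕-upperˡ`.
  record Good (u : Carrier) (a : Seq) : Set c where
    field
      step : ∀ i → a i ⊕ a (suc i) ⊑[ u ] a i
      size : ℕ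
      vanish : ∀ r → size ≤ℕ r → a r ⊑[ u ] 𝟘
  open Good public

  IsGood⇒Good : ∀ {u a} → IsGood a → Good u a
  IsGood⇒Good (s , N , z) = record { step = λ i → ≡⇒⊑ (s i) ; size = N ; vanish = λ r h → ≡⇒⊑ (z r h) }

  Good⇒IsGood : ∀ {a} → Good 𝟙 a → IsGood a
  Good⇒IsGood g = (λ i → ≈⇒≡ (step g i & ⊕-upperˡ)) , size g , λ r h → ≈⇒≡ (vanish g r h & 𝟘-min)

  liftGood : ∀ {u v a} → v ≼ u → Good u a → Good v a
  liftGood e g = record { step = λ i → lift e (step g i) ; size = size g ; vanish = λ r h → lift e (vanish g r h) }

  -- By `⊕-idle` either the first entry is `𝟙` and the tail is treated by induction, or the second
  -- entry is 0 and the decreasing sequence vanishes from there on.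
  shape-bounded : ∀ N {u} a → (∀ i → a i ⊕ a (suc i) ⊑[ u ] a i) → (∀ r → N ≤ℕ r → a r ⊑[ u ] 𝟘) →
                  Locally u (λ v → ∃ λ n → n ≤ℕ N × (a ≈ₛ[ v ] ones n (single (a n))))
  shape-bounded zero a s z k = k ≼-refl (0 , z≤n , pointwise λ where
    zero → ≈-refl
    (suc i) → z (suc i) z≤n & 𝟘-min)
  shape-bounded (suc N) {u} a s z k = ⊕-idle (a 0) (a 1) (s 0) λ where
      e (inj₁ p) → shape-bounded N (λ i → a (suc i)) (λ i → lift e (s (suc i)))
        (λ r h → lift e (z (suc r) (s≤s h)))
        λ { f (n , n≤N , h) → k (≼-trans f e) (suc n , s≤s n≤N , pointwise λ where
          zero → 𝟙-max & lift f p
          (suc i) → at≈ h i) }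
      e (inj₂ p) → k e (0 , z≤n , pointwise λ where
        zero → ≈-refl
        (suc i) → zeros e p i & 𝟘-min)
    where
    zeros : ∀ {v} → v ≼ u → a 1 ⊑[ v ] 𝟘 → ∀ i → a (suc i) ⊑[ v ] 𝟘
    zeros e p zero = p
    zeros e p (suc i) = ⊕-upperʳ ⨾ lift e (s (suc i)) ⨾ zeros e p i

  shape : ∀ {u a} (g : Good u a) → Locally u (λ v → ∃ λ n → n ≤ℕ size g × (a ≈ₛ[ v ] ones n (single (a n))))
  shape {a = a} g = shape-bounded (size g) a (step g) (vanish g)

  ones-step : ∀ {u} n x i → ones n (single x) i ⊕ ones n (single x) (suc i) ⊑[ u ] ones n (single x) i
  ones-step zero x zero = ⊕-𝟘ʳ ⊑-refl
  ones-step zero x (suc i) = ⊕-𝟘ʳ ⊑-refl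
  ones-step (suc n) x zero = 𝟙-max
  ones-step (suc n) x (suc i) = ones-step n x i

  ones-vanish : ∀ n x {r} → suc n ≤ℕ r → ones n (single x) r ≡ 𝟘
  ones-vanish zero x (s≤s _) = refl
  ones-vanish (suc n) x (s≤s h) = ones-vanish n x h

  -- The number of ones depends on the case while `size` must not; the common bound `K` supplies it.
  shaped⇒good : ∀ {u a} K → Locally u (λ v → ∃ λ n → ∃ λ x → n ≤ℕ K × (a ≈ₛ[ v ] ones n (single x))) → Good u a
  shaped⇒good K l = record
    { step = λ i → l λ { e (n , x , _ , h) →
        ⊕-mono (to (at≈ h i)) (to (at≈ h (suc i))) ⨾ ones-step n x i ⨾ from (at≈ h i) }
    ; size = suc K
    ; vanish = λ r K<r → l λ { e (n , x , n≤K , h) →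
        to (at≈ h r) ⨾ ≡⇒⊑ (ones-vanish n x (≤ℕ-trans (s≤s n≤K) K<r)) }
    }

  single-good : ∀ {u} x → Good u (single x)
  single-good x = shaped⇒good 0 (λ k → k ≼-refl (0 , x , z≤n , ≈ₛ-refl))

  0ₛ-Good : ∀ {u} → Good u 0ₛ
  0ₛ-Good = record { step = λ i → ⊕-𝟘ˡ ⊑-refl ; size = 0 ; vanish = λ r _ → ⊑-refl }

  ones-sum : ∀ {u a b} n m {x y} → a ≈ₛ[ u ] ones n (single x) → b ≈ₛ[ u ] ones m (single y) →
             a +ₛ b ≈ₛ[ u ] ones (n + m) ((x ⊕ y) ∷ₛ single (x ⊗ y))
  ones-sum n m {x} {y} p q = ≈ₛ-trans (+ₛ-cong p q) (≐⇒≈ₛ (ones-+ₛ-ones n m x y))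

  ones-sum-full : ∀ {u a b} n m {x y} → a ≈ₛ[ u ] ones n (single x) → b ≈ₛ[ u ] ones m (single y) →
                  𝟙 ⊑[ u ] x ⊕ y → a +ₛ b ≈ₛ[ u ] ones (suc (n + m)) (single (x ⊗ y))
  ones-sum-full n m p q h = ≈ₛ-trans (ones-sum n m p q)
    (≈ₛ-trans (ones-cong (n + m) (∷ₛ-cong (𝟙-max & h) ≈ₛ-refl)) (ones-∷ (n + m)))

  single-𝟘 : ∀ {u x} → x ⊑[ u ] 𝟘 → single x ≈ₛ[ u ] 0ₛ
  single-𝟘 p = pointwise λ where
    zero → p & 𝟘-min
    (suc i) → ≈-refl

  ones-sum-disjoint : ∀ {u a b} n m {x y} → a ≈ₛ[ u ] ones n (single x) → b ≈ₛ[ u ] ones m (single y) →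
                      x ⊗ y ⊑[ u ] 𝟘 → a +ₛ b ≈ₛ[ u ] ones (n + m) (single (x ⊕ y))
  ones-sum-disjoint n m p q h = ≈ₛ-trans (ones-sum n m p q)
    (ones-cong (n + m) (∷ₛ-cong ≈-refl (single-𝟘 h)))

  +ₛ-Good : ∀ {u a b} → Good u a → Good u b → Good u (a +ₛ b)
  -- The successor leaves room for the extra one that appears when the last terms sum to `𝟙`.
  +ₛ-Good {a = a} {b} g h = shaped⇒good (suc (size g + size h)) λ k →
    shape g λ { {v} e (n , n≤ , p) → shape (liftGood e h) λ { f (m , m≤ , q) →
      let p' = lift≈ₛ f p ; n+m≤ = +-mono-≤ n≤ m≤ in ⊕≈𝟙-or-⊗≈𝟘 (a n) (b m) λ where
        g (inj₁ o) → k (≼-trans g (≼-trans f e))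
          (suc (n + m) , _ , s≤s n+m≤ , ones-sum-full n m (lift≈ₛ g p') (lift≈ₛ g q) o)
        g (inj₂ o) → k (≼-trans g (≼-trans f e))
          (n + m , _ , m≤n⇒m≤1+n n+m≤ , ones-sum-disjoint n m (lift≈ₛ g p') (lift≈ₛ g q) o) } }

  ones-total : ∀ {u} n m x y → Locally u (λ v →
    (ones n (single x) ⊑ₛ[ v ] ones m (single y)) ⊎ (ones m (single y) ⊑ₛ[ v ] ones n (single x)))
  ones-total zero zero x y k = prelinear x y λ where
    e (inj₁ p) → k e (inj₁ (∷ₛ-mono p ⊑ₛ-refl))
    e (inj₂ p) → k e (inj₂ (∷ₛ-mono p ⊑ₛ-refl))
  ones-total zero (suc m) x y k = k ≼-refl (inj₁ (∷ₛ-mono 𝟙-max (pointwise λ i → 𝟘-min)))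
  ones-total (suc n) zero x y k = k ≼-refl (inj₂ (∷ₛ-mono 𝟙-max (pointwise λ i → 𝟘-min)))
  ones-total (suc n) (suc m) x y k = ones-total n m x y λ where
    e (inj₁ p) → k e (inj₁ (∷ₛ-mono ⊑-refl p))
    e (inj₂ p) → k e (inj₂ (∷ₛ-mono ⊑-refl p))

  -- Over a chain good sequences are compared by their numbers of ones and then by their last terms.
  -- This turns joins and meets of sequences into one of their arguments.
  ⊑ₛ-total : ∀ {u a b} → Good u a → Good u b → Locally u (λ v → (a ⊑ₛ[ v ] b) ⊎ (b ⊑ₛ[ v ] a))
  ⊑ₛ-total {a = a} {b} g h k = shape g λ { e (n , _ , p) → shape (liftGood e h) λ { f (m , _ , q) →
    ones-total n m (a n) (b m) λ where
      i (inj₁ o) → let p' = lift≈ₛ (≼-trans i f) p ; q' = lift≈ₛ i q in k (≼-trans i (≼-trans f e))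
        (inj₁ (⊑ₛ-trans (≈ₛ⇒⊑ₛ p') (⊑ₛ-trans o (≈ₛ⇒⊑ₛ (≈ₛ-sym q')))))
      i (inj₂ o) → let p' = lift≈ₛ (≼-trans i f) p ; q' = lift≈ₛ i q in k (≼-trans i (≼-trans f e))
        (inj₂ (⊑ₛ-trans (≈ₛ⇒⊑ₛ q') (⊑ₛ-trans o (≈ₛ⇒⊑ₛ (≈ₛ-sym p'))))) } }

  select-good : ∀ {u a b} d → Good u a → Good u b →
                Locally u (λ v → (d ≈ₛ[ v ] a) ⊎ (d ≈ₛ[ v ] b)) → Good u d
  select-good {a = a} {b} d g h l = shaped⇒good (size g + size h) λ k → l λ where
    e (inj₁ o) → shape (liftGood e g) λ { f (n , n≤ , p) →
      k (≼-trans f e) (n , _ , ≤ℕ-trans n≤ (m≤m+n _ _) , ≈ₛ-trans (lift≈ₛ f o) p) }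
    e (inj₂ o) → shape (liftGood e h) λ { f (n , n≤ , p) →
      k (≼-trans f e) (n , _ , ≤ℕ-trans n≤ (m≤n+m _ _) , ≈ₛ-trans (lift≈ₛ f o) p) }

  ∨ₛ-⊑ : ∀ {u a b} → a ⊑ₛ[ u ] b → a ∨ₛ b ≈ₛ[ u ] b
  ∨ₛ-⊑ p = pointwise λ i → ∨-lub (at p i) ⊑-refl & ∨ʳ

  ∨ₛ-⊒ : ∀ {u a b} → b ⊑ₛ[ u ] a → a ∨ₛ b ≈ₛ[ u ] a
  ∨ₛ-⊒ p = pointwise λ i → ∨-lub ⊑-refl (at p i) & ∨ˡ

  ∧ₛ-⊑ : ∀ {u a b} → a ⊑ₛ[ u ] b → a ∧ₛ b ≈ₛ[ u ] a
  ∧ₛ-⊑ p = pointwise λ i → ∧ˡ & ∧-glb ⊑-refl (at p i)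

  ∧ₛ-⊒ : ∀ {u a b} → b ⊑ₛ[ u ] a → a ∧ₛ b ≈ₛ[ u ] b
  ∧ₛ-⊒ p = pointwise λ i → ∧ʳ & ∧-glb (at p i) ⊑-refl

  ∨ₛ-Good : ∀ {u a b} → Good u a → Good u b → Good u (a ∨ₛ b)
  ∨ₛ-Good g h = select-good _ g h λ k → ⊑ₛ-total g h λ where
    e (inj₁ p) → k e (inj₂ (∨ₛ-⊑ p))
    e (inj₂ p) → k e (inj₁ (∨ₛ-⊒ p))

  ∧ₛ-Good : ∀ {u a b} → Good u a → Good u b → Good u (a ∧ₛ b)
  ∧ₛ-Good g h = select-good _ g h λ k → ⊑ₛ-total g h λ where
    e (inj₁ p) → k e (inj₁ (∧ₛ-⊑ p))
    e (inj₂ p) → k e (inj₂ (∧ₛ-⊒ p))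

  +ₛ-distrib-∨ₛ : ∀ {u a b d} → Good u a → Good u b → (a ∨ₛ b) +ₛ d ⊑ₛ[ u ] (a +ₛ d) ∨ₛ (b +ₛ d)
  +ₛ-distrib-∨ₛ g h = locally⊑ₛ (⊑ₛ-total g h) λ where
    e (inj₁ p) → ⊑ₛ-trans (+ₛ-mono (≈ₛ⇒⊑ₛ (∨ₛ-⊑ p)) ⊑ₛ-refl) (pointwise λ i → ∨ʳ)
    e (inj₂ p) → ⊑ₛ-trans (+ₛ-mono (≈ₛ⇒⊑ₛ (∨ₛ-⊒ p)) ⊑ₛ-refl) (pointwise λ i → ∨ˡ)

  +ₛ-distrib-∧ₛ : ∀ {u a b d} → Good u a → Good u b → (a +ₛ d) ∧ₛ (b +ₛ d) ⊑ₛ[ u ] (a ∧ₛ b) +ₛ d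
  +ₛ-distrib-∧ₛ g h = locally⊑ₛ (⊑ₛ-total g h) λ where
    e (inj₁ p) → ⊑ₛ-trans (pointwise λ i → ∧ˡ) (+ₛ-mono (≈ₛ⇒⊑ₛ (≈ₛ-sym (∧ₛ-⊑ p))) ⊑ₛ-refl)
    e (inj₂ p) → ⊑ₛ-trans (pointwise λ i → ∧ʳ) (+ₛ-mono (≈ₛ⇒⊑ₛ (≈ₛ-sym (∧ₛ-⊒ p))) ⊑ₛ-refl)

  +ₛ-comm : ∀ {u a b} → Good u a → Good u b → a +ₛ b ≈ₛ[ u ] b +ₛ a
  +ₛ-comm {a = a} {b} g h = locally≈ₛ (shape g) λ { e (n , _ , p) → locally≈ₛ (shape (liftGood e h)) λ { f (m , _ , q) →
    let p' = lift≈ₛ f p in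
    ≈ₛ-trans (ones-sum n m p' q)
      (≈ₛ-trans (≈ₛ-trans (ones-≡ (+-comm n m))
        (ones-cong (m + n) (∷ₛ-cong (⊕-comm & ⊕-comm) (single-cong (≡⇒≈ (⊗-comm (a n) (b m)))))))
      (≈ₛ-sym (ones-sum m n q p'))) } }

  +ₛ-identityˡ : ∀ {u a} → Good u a → 0ₛ +ₛ a ≈ₛ[ u ] a
  +ₛ-identityˡ g = locally≈ₛ (shape g) λ { e (n , _ , p) →
    ≈ₛ-trans (ones-sum-disjoint 0 n (≈ₛ-sym (single-𝟘 ⊑-refl)) p ⊗-lower)
      (≈ₛ-trans (ones-cong n (single-cong (⊕-𝟘ˡ ⊑-refl & ⊕-upperʳ))) (≈ₛ-sym p)) }

  -- One formula covers both cases: if `x ⊕ y = 𝟙` the first term after the ones is another one, and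
  -- if `x ⊗ y = 0` the third term vanishes.
  ones-sum₃ : ∀ {u a b d} n m p {x y z} →
    a ≈ₛ[ u ] ones n (single x) → b ≈ₛ[ u ] ones m (single y) → d ≈ₛ[ u ] ones p (single z) →
    a +ₛ b +ₛ d ≈ₛ[ u ] ones (n + m + p) (((x ⊕ y) ⊕ z) ∷ₛ carry x y z ∷ₛ single ((x ⊗ y) ⊗ z))
  ones-sum₃ n m p {x} {y} {z} α β γ = locally≈ₛ (⊕≈𝟙-or-⊗≈𝟘 x y) λ where
    e (inj₁ o) → ≈ₛ-trans
      (ones-sum (suc (n + m)) p (ones-sum-full n m (lift≈ₛ e α) (lift≈ₛ e β) o) (lift≈ₛ e γ))
      (≈ₛ-trans (≈ₛ-sym (ones-∷ (n + m + p))) (ones-cong (n + m + p)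
        (∷ₛ-cong ((o ⨾ ⊕-upperˡ) & 𝟙-max)
          (∷ₛ-cong (⊕-cong ≈-refl (⊗-𝟙ˡ o & ⊗-lower')) ≈ₛ-refl))))
    e (inj₂ o) → ≈ₛ-trans
      (ones-sum (n + m) p (ones-sum-disjoint n m (lift≈ₛ e α) (lift≈ₛ e β) o) (lift≈ₛ e γ))
      (ones-cong (n + m + p) (∷ₛ-cong ≈-refl
        (∷ₛ-cong (⊕-upperʳ & ⊕-𝟘ˡ o) (≈ₛ-sym (single-𝟘 (⊗-𝟘ˡ o))))))

  -- The lattice-ordered monoid of good sequences over a class.

  module OnClass (C : Class) (u : Carrier) where
    open Class C

    record Element : Set c where
      field
        seq : Seq
        good : Good u seq
        member : ∀ i → Member u (seq i)
    open Element public

    partialSum-member : ∀ {a b} → (∀ i → Member u (a i)) → (∀ i → Member u (b i)) →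
                        ∀ n j → Member u (partialSum a b n j)
    partialSum-member α β n zero = α n
    partialSum-member α β n (suc j) = ⊕-closed (partialSum-member α β n j) (⊗-closed (α (n ∸ suc j)) (β j))

    infixl 6 _⊞ₑ_
    _⊞ₑ_ : Element → Element → Element
    a ⊞ₑ b = record
      { seq = seq a +ₛ seq b ; good = +ₛ-Good (good a) (good b)
      ; member = λ n → ⊕-closed (partialSum-member (member a) (member b) n n) (member b n) }

    singleₑ : ∀ {x} → Member u x → Element
    singleₑ {x} h = record { seq = single x ; good = single-good x ; member = λ where
      zero → h
      (suc i) → 𝟘-member }

    -- By commutativity it suffices that `(a + b) + d` is invariant under cyclic rotation.
    -- `ones-sum₃` reduces this to three entries, settled by `⊕-assoc`, `carry-rotate` and the laws
    -- of `⊗`.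
    +ₛ-assoc : ∀ a b d → seq a +ₛ seq b +ₛ seq d ≈ₛ[ u ] seq a +ₛ (seq b +ₛ seq d)
    +ₛ-assoc a b d = ≈ₛ-trans rotate (≈ₛ-sym (+ₛ-comm (good a) (good (b ⊞ₑ d))))
      where
      rotate : seq a +ₛ seq b +ₛ seq d ≈ₛ[ u ] seq b +ₛ seq d +ₛ seq a
      rotate =
        locally≈ₛ (shape (good a)) λ { e (n , _ , α) →
        locally≈ₛ (shape (liftGood e (good b))) λ { f (m , _ , β) →
        locally≈ₛ (shape (liftGood (≼-trans f e) (good d))) λ { g (p , _ , γ) →
        let i = ≼-trans g (≼-trans f e)
            α' = lift≈ₛ (≼-trans g f) α
            β' = lift≈ₛ g β
            x∈ = lift i (member a n)
            y∈ = lift i (member b m)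
            z∈ = lift i (member d p)
        in ≈ₛ-trans (ones-sum₃ n m p α' β' γ)
          (≈ₛ-trans (ones-≡ (trans (+-assoc n m p) (+-comm n (m + p))))
          (≈ₛ-trans (ones-cong (m + p + n)
            (∷ₛ-cong ((⊕-comm ⨾ ⊕-mono ⊑-refl ⊕-comm ⨾ ⊕-assoc z∈ y∈ x∈ ⨾ ⊕-mono ⊕-comm ⊑-refl)
                      & (⊕-comm ⨾ ⊕-assoc x∈ y∈ z∈))
            -- The converse inequality consists of two further rotations.
            (∷ₛ-cong (carry-rotate x∈ y∈ z∈ & (carry-rotate y∈ z∈ x∈ ⨾ carry-rotate z∈ x∈ y∈))
              (single-cong (≡⇒≈ (trans (⊗-assoc _ _ _) (⊗-comm _ _)))))))
            (≈ₛ-sym (ones-sum₃ m p n β' γ α')))) } } }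

    latticeMonoid : LatticeMonoid c
    LatticeMonoid.commutativeMonoid latticeMonoid = record
        { Carrier = Element
        ; _≈_ = λ a b → seq a ≈ₛ[ u ] seq b
        ; _∙_ = _⊞ₑ_
        ; ε = record { seq = 0ₛ ; good = 0ₛ-Good ; member = λ i → 𝟘-member }
        ; isCommutativeMonoid = record
          { isMonoid = record
            { isSemigroup = record
              { isMagma = record
                { isEquivalence = record { refl = ≈ₛ-refl ; sym = ≈ₛ-sym ; trans = ≈ₛ-trans }
                ; ∙-cong = +ₛ-cong }
              ; assoc = +ₛ-assoc }
            ; identity = (λ a → +ₛ-identityˡ (good a)) ,
                (λ a → ≈ₛ-trans (+ₛ-comm (good a) 0ₛ-Good) (+ₛ-identityˡ (good a))) }
          ; comm = λ a b → +ₛ-comm (good a) (good b) } }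
    LatticeMonoid._≲_ latticeMonoid = λ a b → seq a ⊑ₛ[ u ] seq b
    LatticeMonoid._⊔_ latticeMonoid = λ a b → record { seq = seq a ∨ₛ seq b ; good = ∨ₛ-Good (good a) (good b)
                             ; member = λ i → ∨-closed (member a i) (member b i) }
    LatticeMonoid._⊓_ latticeMonoid = λ a b → record { seq = seq a ∧ₛ seq b ; good = ∧ₛ-Good (good a) (good b)
                             ; member = λ i → ∧-closed (member a i) (member b i) }
    LatticeMonoid.≲-reflexive latticeMonoid = ≈ₛ⇒⊑ₛ
    LatticeMonoid.≲-trans latticeMonoid = ⊑ₛ-trans
    LatticeMonoid.∙-mono latticeMonoid = +ₛ-mono
    LatticeMonoid.x≲x⊔y latticeMonoid = pointwise λ i → ∨ˡ
    LatticeMonoid.y≲x⊔y latticeMonoid = pointwise λ i → ∨ʳ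
    LatticeMonoid.⊔-least latticeMonoid = λ p q → pointwise λ i → ∨-lub (at p i) (at q i)
    LatticeMonoid.x⊓y≲x latticeMonoid = pointwise λ i → ∧ˡ
    LatticeMonoid.x⊓y≲y latticeMonoid = pointwise λ i → ∧ʳ
    LatticeMonoid.⊓-greatest latticeMonoid = λ p q → pointwise λ i → ∧-glb (at p i) (at q i)
    LatticeMonoid.∙-distrib-⊔ latticeMonoid {x} {y} = +ₛ-distrib-∨ₛ (good x) (good y)
    LatticeMonoid.∙-distrib-⊓ latticeMonoid {x} {y} = +ₛ-distrib-∧ₛ (good x) (good y)

  -- Cancellation of common summands.

  +ₛ-ones : ∀ {u a} n y → Good u a → a +ₛ ones n (single y) ≈ₛ[ u ] ones n (a +ₛ single y)
  +ₛ-ones {a = a} n y g = locally≈ₛ (shape g) λ { e (m , _ , p) →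
    ≈ₛ-trans (ones-sum m n p ≈ₛ-refl) (≈ₛ-trans (ones-≡ (trans (cong (_+ n) (sym (+-identityʳ m))) (+-comm (m + 0) n)))
      (≈ₛ-trans (≈ₛ-sym (ones-+ n (m + 0))) (ones-cong n (≈ₛ-sym (ones-sum m 0 p ≈ₛ-refl))))) }

  -- Leading ones of a summand can be moved in front of the whole sum and stripped off there.
  tail-cancel : ∀ {u a b} n y → Good u a → Good u b →
                a +ₛ ones n (single y) ⊑ₛ[ u ] b +ₛ ones n (single y) → a +ₛ single y ⊑ₛ[ u ] b +ₛ single y
  tail-cancel n y g h p = ones-cancel n
    (⊑ₛ-trans (≈ₛ⇒⊑ₛ (≈ₛ-sym (+ₛ-ones n y g))) (⊑ₛ-trans p (≈ₛ⇒⊑ₛ (+ₛ-ones n y h))))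

  +ₛ-single-𝟘 : ∀ {u a y} → y ⊑[ u ] 𝟘 → Good u a → a +ₛ single y ≈ₛ[ u ] a
  +ₛ-single-𝟘 o g = ≈ₛ-trans (+ₛ-cong ≈ₛ-refl (single-𝟘 o)) (≈ₛ-trans (+ₛ-comm g 0ₛ-Good) (+ₛ-identityˡ g))

  units-cancel : ∀ {u a b y} n → y ⊑[ u ] 𝟘 → Good u a → Good u b →
                 a +ₛ ones n (single y) ⊑ₛ[ u ] b +ₛ ones n (single y) → a ⊑ₛ[ u ] b
  units-cancel n o g h p = ⊑ₛ-trans (≈ₛ⇒⊑ₛ (≈ₛ-sym (+ₛ-single-𝟘 o g)))
    (⊑ₛ-trans (tail-cancel n _ g h p) (≈ₛ⇒⊑ₛ (+ₛ-single-𝟘 o h)))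

  liftElement : ∀ {C u v} → v ≼ u → OnClass.Element C u → OnClass.Element C v
  liftElement e x = record
    { seq = OnClass.seq x ; good = liftGood e (OnClass.good x) ; member = λ i → lift e (OnClass.member x i) }

  mv-cancel : ∀ {u} (a b d : OnClass.Element mvClass u) →
              OnClass.seq a +ₛ OnClass.seq d ⊑ₛ[ u ] OnClass.seq b +ₛ OnClass.seq d →
              OnClass.seq a ⊑ₛ[ u ] OnClass.seq b
  mv-cancel a b d p = locally⊑ₛ (shape (OnClass.good d)) λ { e (n , _ , α) →
    subtract n (liftElement e a) (liftElement e b) (liftElement e d) α (lift⊑ₛ e p) }
    where
    -- d = (1, …, 1, z) is complemented: d + (¬z) = (1, …, 1).
    module _ {v : Carrier} (n : ℕ) where
      open OnClass mvClass v
      fill : ∀ x d → seq d ≈ₛ[ v ] ones n (single (seq d n)) →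
             seq x +ₛ seq d +ₛ single (¬ seq d n) ≈ₛ[ v ]
             seq x +ₛ ones (suc (n + 0)) (single (seq d n ⊗ ¬ seq d n))
      fill x d α = ≈ₛ-trans (+ₛ-assoc x d (singleₑ ¬¬¬))
        (+ₛ-cong ≈ₛ-refl (ones-sum-full n 0 α ≈ₛ-refl (𝟙⊑-⊕ ⊑-refl (member d n))))
      subtract : ∀ a b d → seq d ≈ₛ[ v ] ones n (single (seq d n)) →
                 seq a +ₛ seq d ⊑ₛ[ v ] seq b +ₛ seq d → seq a ⊑ₛ[ v ] seq b
      subtract a b d α p = units-cancel (suc (n + 0)) ⊗¬ (good a) (good b)
        (⊑ₛ-trans (≈ₛ⇒⊑ₛ (≈ₛ-sym (fill a d α))) (⊑ₛ-trans (+ₛ-mono p ⊑ₛ-refl) (≈ₛ⇒⊑ₛ (fill b d α))))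

  -- Transfer from lattice monoids to good sequences

  -- Kept apart from `evaluate`: arbitrary good sequences need not form a `LatticeMonoid`, since
  -- their sum may fail to be associative.
  ⟦_⟧ : ∀ {n} → Expr n → (Fin n → Seq) → Seq
  ⟦ var j ⟧ ρ = ρ j
  ⟦ null ⟧ ρ = 0ₛ
  ⟦ e ⊹ f ⟧ ρ = ⟦ e ⟧ ρ +ₛ ⟦ f ⟧ ρ
  ⟦ e ⊻ f ⟧ ρ = ⟦ e ⟧ ρ ∨ₛ ⟦ f ⟧ ρ
  ⟦ e ⊼ f ⟧ ρ = ⟦ e ⟧ ρ ∧ₛ ⟦ f ⟧ ρ

  ∨ₛ-mono : ∀ {u a a' b b'} → a ⊑ₛ[ u ] a' → b ⊑ₛ[ u ] b' → a ∨ₛ b ⊑ₛ[ u ] a' ∨ₛ b'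
  ∨ₛ-mono p q = pointwise λ i → ∨-mono (at p i) (at q i)

  ∧ₛ-mono : ∀ {u a a' b b'} → a ⊑ₛ[ u ] a' → b ⊑ₛ[ u ] b' → a ∧ₛ b ⊑ₛ[ u ] a' ∧ₛ b'
  ∧ₛ-mono p q = pointwise λ i → ∧-mono (at p i) (at q i)

  ∨ₛ-cong : ∀ {u a a' b b'} → a ≈ₛ[ u ] a' → b ≈ₛ[ u ] b' → a ∨ₛ b ≈ₛ[ u ] a' ∨ₛ b'
  ∨ₛ-cong p q = ⊑ₛ-antisym (∨ₛ-mono (≈ₛ⇒⊑ₛ p) (≈ₛ⇒⊑ₛ q)) (∨ₛ-mono (≈ₛ⇒⊑ₛ (≈ₛ-sym p)) (≈ₛ⇒⊑ₛ (≈ₛ-sym q)))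

  ∧ₛ-cong : ∀ {u a a' b b'} → a ≈ₛ[ u ] a' → b ≈ₛ[ u ] b' → a ∧ₛ b ≈ₛ[ u ] a' ∧ₛ b'
  ∧ₛ-cong p q = ⊑ₛ-antisym (∧ₛ-mono (≈ₛ⇒⊑ₛ p) (≈ₛ⇒⊑ₛ q)) (∧ₛ-mono (≈ₛ⇒⊑ₛ (≈ₛ-sym p)) (≈ₛ⇒⊑ₛ (≈ₛ-sym q)))

  ⟦⟧-Good : ∀ {u n} {ρ : Fin n → Seq} (e : Expr n) → (∀ j → Good u (ρ j)) → Good u (⟦ e ⟧ ρ)
  ⟦⟧-Good (var j) g = g j
  ⟦⟧-Good null g = 0ₛ-Good
  ⟦⟧-Good (e ⊹ f) g = +ₛ-Good (⟦⟧-Good e g) (⟦⟧-Good f g)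
  ⟦⟧-Good (e ⊻ f) g = ∨ₛ-Good (⟦⟧-Good e g) (⟦⟧-Good f g)
  ⟦⟧-Good (e ⊼ f) g = ∧ₛ-Good (⟦⟧-Good e g) (⟦⟧-Good f g)

  evaluate-seq : ∀ {C u n} (σ : Fin n → OnClass.Element C u) e →
    OnClass.seq (evaluate (OnClass.latticeMonoid C u) σ e) ≈ₛ[ u ] ⟦ e ⟧ (λ j → OnClass.seq (σ j))
  evaluate-seq σ (var j) = ≈ₛ-refl
  evaluate-seq σ null = ≈ₛ-refl
  evaluate-seq σ (e ⊹ f) = +ₛ-cong (evaluate-seq σ e) (evaluate-seq σ f)
  evaluate-seq σ (e ⊻ f) = ∨ₛ-cong (evaluate-seq σ e) (evaluate-seq σ f)
  evaluate-seq σ (e ⊼ f) = ∧ₛ-cong (evaluate-seq σ e) (evaluate-seq σ f)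

  infix 9 ¬¬ₛ_
  ¬¬ₛ_ : Seq → Seq
  (¬¬ₛ a) i = ¬ ¬ a i

  ¬¬ₛ-intro : ∀ {u a} → a ⊑ₛ[ u ] ¬¬ₛ a
  ¬¬ₛ-intro = pointwise λ i → ¬¬-intro

  ¬¬ₛ-mono : ∀ {u a b} → a ⊑ₛ[ u ] b → ¬¬ₛ a ⊑ₛ[ u ] ¬¬ₛ b
  ¬¬ₛ-mono p = pointwise λ i → ¬¬-mono (at p i)

  ¬¬-partialSum : ∀ {u} a b n j → ¬ ¬ (partialSum a b n j) ≈[ u ] partialSum (¬¬ₛ a) (¬¬ₛ b) n j
  ¬¬-partialSum a b n zero = ≈-refl
  ¬¬-partialSum a b n (suc j) = ≈-trans ¬¬-⊕ (⊕-cong (¬¬-partialSum a b n j) ¬¬-⊗)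

  -- Lets a law among the MV sequences `¬¬ₛ ρ j` be read as a statement on the double negation of
  -- its value at `ρ`.
  ¬¬ₛ-⟦⟧ : ∀ {u n} {ρ : Fin n → Seq} e → ¬¬ₛ ⟦ e ⟧ ρ ≈ₛ[ u ] ⟦ e ⟧ (λ j → ¬¬ₛ ρ j)
  ¬¬ₛ-⟦⟧ (var j) = ≈ₛ-refl
  ¬¬ₛ-⟦⟧ null = pointwise λ i → ¬¬𝟘 ⊑-refl & 𝟘-min
  ¬¬ₛ-⟦⟧ {ρ = ρ} (e ⊹ f) = ≈ₛ-trans
    (pointwise λ n → ≈-trans ¬¬-⊕ (⊕-cong (¬¬-partialSum (⟦ e ⟧ ρ) (⟦ f ⟧ ρ) n n) ≈-refl))
    (+ₛ-cong (¬¬ₛ-⟦⟧ e) (¬¬ₛ-⟦⟧ f))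
  ¬¬ₛ-⟦⟧ (e ⊻ f) = ≈ₛ-trans (pointwise λ n → ¬¬-∨) (∨ₛ-cong (¬¬ₛ-⟦⟧ e) (¬¬ₛ-⟦⟧ f))
  ¬¬ₛ-⟦⟧ (e ⊼ f) = ≈ₛ-trans (pointwise λ n → ¬¬-∧) (∧ₛ-cong (¬¬ₛ-⟦⟧ e) (¬¬ₛ-⟦⟧ f))

  ¬¬ₛ-Good : ∀ {u a} → Good u a → Good u (¬¬ₛ a)
  ¬¬ₛ-Good g = record
    { step = λ i → from ¬¬-⊕ ⨾ ¬¬-mono (step g i)
    ; size = size g
    ; vanish = λ r h → ¬¬𝟘 (vanish g r h) }

  ⋁ ⋀ : ∀ n → (Fin n → Carrier) → Carrier
  ⋁ n = foldr _∨_ 𝟘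
  ⋀ n = foldr _∧_ 𝟙

  ⋁-upper : ∀ {u n} (f : Fin n → Carrier) j → f j ⊑[ u ] ⋁ n f
  ⋁-upper f zero = ∨ˡ
  ⋁-upper f (suc j) = ⋁-upper (λ i → f (suc i)) j ⨾ ∨ʳ

  ⋀-lower : ∀ {u n} (f : Fin n → Carrier) j → ⋀ n f ⊑[ u ] f j
  ⋀-lower f zero = ∧ˡ
  ⋀-lower f (suc j) = ∧ʳ ⨾ ⋀-lower (λ i → f (suc i)) j

  ⋀-greatest : ∀ {u x} n (f : Fin n → Carrier) → (∀ j → x ⊑[ u ] f j) → x ⊑[ u ] ⋀ n f
  ⋀-greatest zero f h = 𝟙-max
  ⋀-greatest (suc n) f h = ∧-glb (h zero) (⋀-greatest n (λ i → f (suc i)) (λ j → h (suc j)))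

  -- The mixed product is avoided by treating `x` and `y` as comparable.
  ∨-nilpotent : ∀ {u x y} → x ⊗ x ⊑[ u ] 𝟘 → y ⊗ y ⊑[ u ] 𝟘 → (x ∨ y) ⊗ (x ∨ y) ⊑[ u ] 𝟘
  ∨-nilpotent {x = x} {y} p q = prelinear x y λ where
    e (inj₁ o) → ⊗-mono⊑ (∨-lub o ⊑-refl) (∨-lub o ⊑-refl) ⨾ lift e q
    e (inj₂ o) → ⊗-mono⊑ (∨-lub ⊑-refl o) (∨-lub ⊑-refl o) ⨾ lift e p

  ⋁-nilpotent : ∀ {u} n (f : Fin n → Carrier) → (∀ j → f j ⊗ f j ⊑[ u ] 𝟘) → ⋁ n f ⊗ ⋁ n f ⊑[ u ] 𝟘
  ⋁-nilpotent zero f h = ⊗-lower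
  ⋁-nilpotent (suc n) f h = ∨-nilpotent (h zero) (⋁-nilpotent n (λ i → f (suc i)) (λ j → h (suc j)))

  -- The one-term witness and the transfer of laws.

  module Absorber {n : ℕ} (ρ : Fin n → Seq) (ρ-good : ∀ j → IsGood (ρ j)) (T : Expr n) where

    ρ-Good : ∀ {u} j → Good u (ρ j)
    ρ-Good j = IsGood⇒Good (ρ-good j)

    S : Seq
    S = ⟦ T ⟧ ρ

    S-good : Good 𝟙 S
    S-good = ⟦⟧-Good T ρ-Good

    boundary : Carrier → Carrier
    boundary x = x ∧ ¬ x

    κ : Carrier
    κ = ⋁ n λ j → ⋁ (size (ρ-Good {𝟙} j)) λ i → boundary (ρ j (toℕ i))

    -- Extracts the last term of `S`, whatever its position: when `κ = 0`, an entry 0 or `𝟙`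
    -- contributes `𝟙` to the meet, and a dense entry contributes itself.
    ω : Carrier
    ω = ⋀ (suc (size S-good)) λ i → S (toℕ i) ∨ ¬ S (toℕ i)

    -- In a chain, clamped is ω when κ = 0, and otherwise it lies between κ and ¬κ, strictly
    -- inside the MV-component of the chain, where it absorbs every dense element.
    clamped : Carrier
    clamped = (ω ∧ ¬ κ) ∨ κ

    absorber : Seq
    absorber = single clamped

    absorber-good : IsGood absorber
    absorber-good = Good⇒IsGood (single-good clamped)

    boundary-nilpotent : ∀ {u x} → boundary x ⊗ boundary x ⊑[ u ] 𝟘
    boundary-nilpotent = ⊗-mono⊑ ∧ˡ ∧ʳ ⨾ ⊗¬

    κ⊑¬κ : ∀ {u} → κ ⊑[ u ] ¬ κ
    κ⊑¬κ = ⊑¬ (⋁-nilpotent n _ λ j → ⋁-nilpotent (size (ρ-Good {𝟙} j)) _ λ i → boundary-nilpotent)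

    clamped⊑¬κ : ∀ {u} → clamped ⊑[ u ] ¬ κ
    clamped⊑¬κ = ∨-lub ∧ʳ κ⊑¬κ

    ρ-crisp : ∀ {u} → κ ⊑[ u ] 𝟘 → ∀ j i → Crisp u (ρ j i)
    ρ-crisp {u} κ⊑𝟘 j i with i <? size (ρ-Good {𝟙} j)
    ... | yes i< = ≡⇒⊑ (cong (λ k → boundary (ρ j k)) (sym (toℕ-fromℕ< i<)))
                   ⨾ ⋁-upper (λ i → boundary (ρ j (toℕ i))) (fromℕ< i<)
                   ⨾ ⋁-upper (λ j → ⋁ (size (ρ-Good {𝟙} j)) λ i → boundary (ρ j (toℕ i))) j ⨾ κ⊑𝟘
    ... | no i≮ = ∧ˡ ⨾ vanish (ρ-Good j) i (≮⇒≥ i≮)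

    ones-∨¬ : ∀ {u} m x i → x ⊑[ u ] ones m (single x) i ∨ ¬ ones m (single x) i
    ones-∨¬ zero x zero = ∨ˡ
    ones-∨¬ zero x (suc i) = 𝟙-max ⨾ ¬𝟘 ⊑-refl ⨾ ∨ʳ
    ones-∨¬ (suc m) x zero = 𝟙-max ⨾ ∨ˡ
    ones-∨¬ (suc m) x (suc i) = ones-∨¬ m x i

    -- With `κ = 0` clamping changes nothing and leaves `ω`. A dense `S m` equals `S m ∨ ¬ S m`, and
    -- all other entries of `S` contribute `𝟙`.
    clamped≈dense-tail : ∀ {u m} → κ ⊑[ u ] 𝟘 → m ≤ℕ size S-good → S ≈ₛ[ u ] ones m (single (S m)) →
                         Dense u (S m) → clamped ≈[ u ] S m
    clamped≈dense-tail {u} {m} κ⊑𝟘 m≤ p δ = ∨-lub (∧ˡ ⨾ ω⊑) (κ⊑𝟘 ⨾ 𝟘-min) & (∧-glb ⊑ω (𝟙-max ⨾ ¬𝟘 κ⊑𝟘) ⨾ ∨ˡ)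
      where
      ω⊑ : ω ⊑[ u ] S m
      ω⊑ = ⋀-lower (λ i → S (toℕ i) ∨ ¬ S (toℕ i)) (fromℕ< (s≤s m≤))
         ⨾ ≡⇒⊑ (cong (λ k → S k ∨ ¬ S k) (toℕ-fromℕ< (s≤s m≤)))
         ⨾ ∨-lub ⊑-refl (δ ⨾ 𝟘-min)
      ⊑ω : S m ⊑[ u ] ω
      ⊑ω = ⋀-greatest (suc (size S-good)) _ λ i → ones-∨¬ m (S m) (toℕ i)
         ⨾ ∨-mono (from (at≈ p (toℕ i))) (¬-anti (to (at≈ p (toℕ i))))

    -- If the last term of `S` is 0, then `S` is a block of ones and cancels altogether. If it is
    -- dense, `absorber` consists of just this term and only the ones are cancelled.
    crisp-absorb : ∀ {u X Y} → κ ⊑[ u ] 𝟘 → (∀ i → Crisp u (S i)) → Good u X → Good u Y →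
                   X +ₛ S ⊑ₛ[ u ] Y +ₛ S → X +ₛ absorber ⊑ₛ[ u ] Y +ₛ absorber
    crisp-absorb κ⊑𝟘 crisp g h q = locally⊑ₛ (shape (liftGood 𝟙-≼ S-good)) λ { e (m , m≤ , p) →
      let shifted = ⊑ₛ-trans (+ₛ-mono ⊑ₛ-refl (≈ₛ⇒⊑ₛ (≈ₛ-sym p)))
                      (⊑ₛ-trans (lift⊑ₛ e q) (+ₛ-mono ⊑ₛ-refl (≈ₛ⇒⊑ₛ p)))
      in locally⊑ₛ (crisp-cases (S m) (lift e (crisp m))) λ where
        f (inj₁ o) → let e' = ≼-trans f e in
          +ₛ-mono (units-cancel m o (liftGood e' g) (liftGood e' h) (lift⊑ₛ f shifted)) ⊑ₛ-refl
        f (inj₂ δ) → let e' = ≼-trans f e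
                         tail = single-cong (clamped≈dense-tail (lift e' κ⊑𝟘) m≤ (lift≈ₛ f p) δ) in
          ⊑ₛ-trans (≈ₛ⇒⊑ₛ (+ₛ-cong ≈ₛ-refl tail))
            (⊑ₛ-trans (tail-cancel m (S m) (liftGood e' g) (liftGood e' h) (lift⊑ₛ f shifted))
              (≈ₛ⇒⊑ₛ (+ₛ-cong ≈ₛ-refl (≈ₛ-sym tail)))) }

    -- An MV last term of `Y` equals its double negation. A dense one below `¬ κ` forces `κ = 0`,
    -- and so does a dense `clamped`, as `clamped ⊑ ¬ κ`. There remains a dense term above `¬ κ`
    -- with `clamped` MV.
    mv-absorb : ∀ {u Y} → Good u Y →
                Locally u (λ v → (κ ⊑[ v ] 𝟘) ⊎ (¬¬ₛ Y +ₛ absorber ⊑ₛ[ v ] Y +ₛ absorber))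
    mv-absorb {Y = Y} g k = shape g λ { e (m , _ , p) → MV-or-dense (Y m) λ where
      f (inj₁ y-mv) → k (≼-trans f e) (inj₂ (+ₛ-mono
        (⊑ₛ-trans (¬¬ₛ-mono (≈ₛ⇒⊑ₛ (lift≈ₛ f p))) (⊑ₛ-trans (ones-mv m y-mv) (≈ₛ⇒⊑ₛ (≈ₛ-sym (lift≈ₛ f p)))))
        ⊑ₛ-refl))
      f (inj₂ δ) → prelinear (Y m) (¬ κ) λ where
        i (inj₁ o) → k (≼-trans i (≼-trans f e)) (inj₁ (¬¬-intro ⨾ ¬-anti o ⨾ lift i δ))
        i (inj₂ o) → MV-or-dense clamped λ where
          j (inj₂ ε) → k (≼-trans j (≼-trans i (≼-trans f e))) (inj₁ (⊑¬-swap clamped⊑¬κ ⨾ ε))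
          j (inj₁ c-mv) → k (≼-trans j (≼-trans i (≼-trans f e))) (inj₂
            (absorbed m (lift≈ₛ (≼-trans j (≼-trans i f)) p) (lift (≼-trans j i) δ) (lift j o) c-mv)) }
      where
      ones-mv : ∀ {v x} m → MV v x → ¬¬ₛ ones m (single x) ⊑ₛ[ v ] ones m (single x)
      ones-mv zero h = pointwise λ where
        zero → h
        (suc i) → ¬¬𝟘 ⊑-refl
      ones-mv (suc m) h = pointwise λ where
        zero → 𝟙-max
        (suc i) → at (ones-mv m h) i
      ¬¬ₛ-ones : ∀ {v x} m → ¬¬ₛ ones m (single x) ≈ₛ[ v ] ones m (single (¬ ¬ x))
      ¬¬ₛ-ones zero = pointwise λ where
        zero → ≈-refl
        (suc i) → ¬¬𝟘 ⊑-refl & 𝟘-min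
      ¬¬ₛ-ones (suc m) = pointwise λ where
        zero → 𝟙-max & ¬¬-intro
        (suc i) → at≈ (¬¬ₛ-ones m) i
      absorbed : ∀ {v} m → Y ≈ₛ[ v ] ones m (single (Y m)) → Dense v (Y m) → ¬ κ ⊑[ v ] Y m → MV v clamped →
                 ¬¬ₛ Y +ₛ absorber ⊑ₛ[ v ] Y +ₛ absorber
      absorbed m p δ o c-mv = ⊑ₛ-trans
        (≈ₛ⇒⊑ₛ (ones-sum m 0 (≈ₛ-trans (⊑ₛ-antisym (¬¬ₛ-mono (≈ₛ⇒⊑ₛ p)) (¬¬ₛ-mono (≈ₛ⇒⊑ₛ (≈ₛ-sym p)))) (¬¬ₛ-ones m)) ≈ₛ-refl))
        -- With y the last term of `Y` and c for `clamped`, y ⊕ c is `𝟙` because `¬ c ⊑ ¬ κ ⊑ y` and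
        -- `¬ y = 0`, and y ⊗ c is c by `MV-⊗-dense`.
        (⊑ₛ-trans (ones-mono (m + 0) (∷ₛ-mono (𝟙-max ⨾ 𝟙⊑-⊕ (δ ⨾ 𝟘-min) (¬-anti ∨ʳ ⨾ o))
            (∷ₛ-mono (⊗-lower' ⨾ MV-⊗-dense δ c-mv (clamped⊑¬κ ⨾ o)) ⊑ₛ-refl)))
          (≈ₛ⇒⊑ₛ (≈ₛ-sym (ones-sum m 0 p ≈ₛ-refl))))

    -- The entailment is used twice: among the MV sequences `¬¬ₛ ρ j`, where `T` cancels, and where
    -- `κ = 0` among the crisp sequences `ρ j` themselves, where `absorber` replaces `T`.
    transfer : (H : List (Expr n × Expr n)) (X Y : Expr n) →
               (∀ (M : LatticeMonoid c) σ → All (Holds M σ) H → Holds M σ (X ⊹ T , Y ⊹ T)) →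
               All (λ (e , f) → ⟦ e ⟧ ρ ≤ₛ ⟦ f ⟧ ρ) H →
               ⟦ X ⟧ ρ +ₛ absorber ≤ₛ ⟦ Y ⟧ ρ +ₛ absorber
    transfer H X Y entails hyps i = ⊑⇒≤ (at goal i)
      where
      ev : ∀ C u → (Fin n → OnClass.Element C u) → Expr n → OnClass.Element C u
      ev C u = evaluate (OnClass.latticeMonoid C u)

      realise : ∀ C u (σ : Fin n → OnClass.Element C u) →
                (∀ e f → ⟦ e ⟧ ρ ≤ₛ ⟦ f ⟧ ρ → ⟦ e ⟧ (λ j → OnClass.seq (σ j)) ⊑ₛ[ u ] ⟦ f ⟧ (λ j → OnClass.seq (σ j))) →
                OnClass.seq (ev C u σ X) +ₛ OnClass.seq (ev C u σ T) ⊑ₛ[ u ]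
                OnClass.seq (ev C u σ Y) +ₛ OnClass.seq (ev C u σ T)
      realise C u σ push = entails (OnClass.latticeMonoid C u) σ
        (All.map (λ {(e , f)} h → ⊑ₛ-trans (≈ₛ⇒⊑ₛ (evaluate-seq σ e))
          (⊑ₛ-trans (push e f h) (≈ₛ⇒⊑ₛ (≈ₛ-sym (evaluate-seq σ f))))) hyps)

      mvσ : Fin n → OnClass.Element mvClass 𝟙
      mvσ j = record { seq = ¬¬ₛ ρ j ; good = ¬¬ₛ-Good (ρ-Good j) ; member = λ i → ¬¬¬ }

      evaluated : ∀ e → OnClass.seq (ev mvClass 𝟙 mvσ e) ≈ₛ[ 𝟙 ] ¬¬ₛ ⟦ e ⟧ ρ
      evaluated e = ≈ₛ-trans (evaluate-seq mvσ e) (≈ₛ-sym (¬¬ₛ-⟦⟧ e))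

      push-¬¬ : ∀ e f → ⟦ e ⟧ ρ ≤ₛ ⟦ f ⟧ ρ → ⟦ e ⟧ (λ j → ¬¬ₛ ρ j) ⊑ₛ[ 𝟙 ] ⟦ f ⟧ (λ j → ¬¬ₛ ρ j)
      push-¬¬ e f h = ⊑ₛ-trans (≈ₛ⇒⊑ₛ (≈ₛ-sym (¬¬ₛ-⟦⟧ e)))
        (⊑ₛ-trans (pointwise λ i → ¬¬-mono (≤⇒⊑ (h i))) (≈ₛ⇒⊑ₛ (¬¬ₛ-⟦⟧ f)))

      ¬¬-X⊑Y : ¬¬ₛ ⟦ X ⟧ ρ ⊑ₛ[ 𝟙 ] ¬¬ₛ ⟦ Y ⟧ ρ
      ¬¬-X⊑Y = ⊑ₛ-trans (≈ₛ⇒⊑ₛ (≈ₛ-sym (evaluated X))) (⊑ₛ-trans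
        (mv-cancel (ev mvClass 𝟙 mvσ X) (ev mvClass 𝟙 mvσ Y) (ev mvClass 𝟙 mvσ T)
          (realise mvClass 𝟙 mvσ push-¬¬))
        (≈ₛ⇒⊑ₛ (evaluated Y)))

      goal : ⟦ X ⟧ ρ +ₛ absorber ⊑ₛ[ 𝟙 ] ⟦ Y ⟧ ρ +ₛ absorber
      goal = locally⊑ₛ (mv-absorb (⟦⟧-Good Y ρ-Good)) λ where
        -- Here `X ⊑ ¬ ¬ X ⊑ ¬ ¬ Y`, and adding `absorber` takes `¬ ¬ Y` back to `Y`.
        e (inj₂ p) → ⊑ₛ-trans (+ₛ-mono (⊑ₛ-trans ¬¬ₛ-intro (lift⊑ₛ e ¬¬-X⊑Y)) ⊑ₛ-refl) p
        {v} e (inj₁ κ⊑𝟘) →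
          let σ : Fin n → OnClass.Element crispClass v
              σ j = record { seq = ρ j ; good = ρ-Good j ; member = ρ-crisp κ⊑𝟘 j }
          in crisp-absorb κ⊑𝟘
               (λ i → crisp-cong (at≈ (evaluate-seq σ T) i) (OnClass.member (ev crispClass v σ T) i))
               (⟦⟧-Good X ρ-Good) (⟦⟧-Good Y ρ-Good)
               (⊑ₛ-trans (≈ₛ⇒⊑ₛ (≈ₛ-sym (+ₛ-cong (evaluate-seq σ X) (evaluate-seq σ T))))
                 (⊑ₛ-trans (realise crispClass v σ (λ e f h → pointwise λ i → ≤⇒⊑ (h i)))
                   (≈ₛ⇒⊑ₛ (+ₛ-cong (evaluate-seq σ Y) (evaluate-seq σ T)))))

-- The group and lattice laws in an arbitrary lattice-ordered monoid.

module Inequalities {c : Level} (M : LatticeMonoid c) where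
  open LatticeMonoid M
  open CommutativeMonoid commutativeMonoid using () renaming (refl to ≈-refl)
  open import Algebra.Solver.CommutativeMonoid commutativeMonoid using (solve; _⊜_; _⊕_; id)

  infixr 3 _⨟_
  _⨟_ : ∀ {x y z} → x ≲ y → y ≲ z → x ≲ z
  _⨟_ = ≲-trans

  ≲-refl : ∀ {x} → x ≲ x
  ≲-refl = ≲-reflexive ≈-refl

  -- The hypotheses are added; the middle pair `p`, `d` then occurs on both sides and joins the
  -- common summand.
  chain : ∀ {a b p d e f k l} → a ∙ d ∙ k ≲ b ∙ p ∙ k → p ∙ f ∙ l ≲ d ∙ e ∙ l →
          a ∙ f ∙ ((p ∙ d) ∙ (k ∙ l)) ≲ b ∙ e ∙ ((p ∙ d) ∙ (k ∙ l))
  chain {a} {b} {p} {d} {e} {f} {k} {l} h h' =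
    ≲-reflexive (solve 6 (λ a p d f k l →
      (a ⊕ f) ⊕ ((p ⊕ d) ⊕ (k ⊕ l)) ⊜ ((a ⊕ d) ⊕ k) ⊕ ((p ⊕ f) ⊕ l)) ≈-refl a p d f k l)
    ⨟ ∙-mono h h'
    ⨟ ≲-reflexive (solve 6 (λ b p d e k l →
      ((b ⊕ p) ⊕ k) ⊕ ((d ⊕ e) ⊕ l) ⊜ (b ⊕ e) ⊕ ((p ⊕ d) ⊕ (k ⊕ l))) ≈-refl b p d e k l)

  widenˡ : ∀ {x y k l} → x ∙ k ≲ y ∙ k → x ∙ (k ∙ l) ≲ y ∙ (k ∙ l)
  widenˡ {x} {y} {k} {l} h = regroup x ⨟ ∙-mono h ≲-refl ⨟ ≲-reflexive
      (solve 3 (λ y k l → (y ⊕ k) ⊕ l ⊜ y ⊕ (k ⊕ l)) ≈-refl y k l)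
    where
    regroup : ∀ x → x ∙ (k ∙ l) ≲ (x ∙ k) ∙ l
    regroup x = ≲-reflexive (solve 3 (λ x k l → x ⊕ (k ⊕ l) ⊜ (x ⊕ k) ⊕ l) ≈-refl x k l)

  flip-widenʳ : ∀ {a b p d k l} → p ∙ b ∙ l ≲ d ∙ a ∙ l → b ∙ p ∙ (k ∙ l) ≲ a ∙ d ∙ (k ∙ l)
  flip-widenʳ {a} {b} {p} {d} {k} {l} h =
    ≲-reflexive (solve 4 (λ b p k l → (b ⊕ p) ⊕ (k ⊕ l) ⊜ ((p ⊕ b) ⊕ l) ⊕ k) ≈-refl b p k l)
    ⨟ ∙-mono h ≲-refl
    ⨟ ≲-reflexive (solve 4 (λ a d k l → ((d ⊕ a) ⊕ l) ⊕ k ⊜ (a ⊕ d) ⊕ (k ⊕ l)) ≈-refl a d k l)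

  flip : ∀ {a b p d k} → b ∙ p ∙ k ≲ a ∙ d ∙ k → p ∙ b ∙ k ≲ d ∙ a ∙ k
  flip {a} {b} {p} {d} {k} h =
    ≲-reflexive (solve 3 (λ b p k → (p ⊕ b) ⊕ k ⊜ (b ⊕ p) ⊕ k) ≈-refl b p k) ⨟ h
    ⨟ ≲-reflexive (solve 3 (λ a d k → (a ⊕ d) ⊕ k ⊜ (d ⊕ a) ⊕ k) ≈-refl a d k)

  add : ∀ {a b a' b' p d p' d' k l} → a ∙ b' ∙ k ≲ b ∙ a' ∙ k → p ∙ d' ∙ l ≲ d ∙ p' ∙ l →
        a ∙ p ∙ (b' ∙ d') ∙ (k ∙ l) ≲ b ∙ d ∙ (a' ∙ p') ∙ (k ∙ l)
  add {a} {b} {a'} {b'} {p} {d} {p'} {d'} {k} {l} h h' =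
    ≲-reflexive (solve 6 (λ a b' p d' k l →
      ((a ⊕ p) ⊕ (b' ⊕ d')) ⊕ (k ⊕ l) ⊜ ((a ⊕ b') ⊕ k) ⊕ ((p ⊕ d') ⊕ l)) ≈-refl a b' p d' k l)
    ⨟ ∙-mono h h'
    ⨟ ≲-reflexive (solve 6 (λ b a' d p' k l →
      ((b ⊕ a') ⊕ k) ⊕ ((d ⊕ p') ⊕ l) ⊜ ((b ⊕ d) ⊕ (a' ⊕ p')) ⊕ (k ⊕ l)) ≈-refl b a' d p' k l)

  upperˡ : ∀ {a b p d} → a ∙ (b ∙ d) ∙ ε ≲ b ∙ (a ∙ d ⊔ b ∙ p) ∙ ε
  upperˡ {a} {b} {p} {d} =
    ≲-reflexive (solve 3 (λ a b d → (a ⊕ (b ⊕ d)) ⊕ id ⊜ (b ⊕ (a ⊕ d)) ⊕ id) ≈-refl a b d)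
    ⨟ ∙-mono (∙-mono ≲-refl x≲x⊔y) ≲-refl

  upperʳ : ∀ {a b p d} → p ∙ (b ∙ d) ∙ ε ≲ d ∙ (a ∙ d ⊔ b ∙ p) ∙ ε
  upperʳ {a} {b} {p} {d} =
    ≲-reflexive (solve 3 (λ p b d → (p ⊕ (b ⊕ d)) ⊕ id ⊜ (d ⊕ (b ⊕ p)) ⊕ id) ≈-refl p b d)
    ⨟ ∙-mono (∙-mono ≲-refl y≲x⊔y) ≲-refl

  lowerˡ : ∀ {a b p d} → (a ∙ d ⊓ b ∙ p) ∙ b ∙ ε ≲ b ∙ d ∙ a ∙ ε
  lowerˡ {a} {b} {p} {d} = ∙-mono (∙-mono x⊓y≲x ≲-refl) ≲-refl
    ⨟ ≲-reflexive (solve 3 (λ a b d → ((a ⊕ d) ⊕ b) ⊕ id ⊜ ((b ⊕ d) ⊕ a) ⊕ id) ≈-refl a b d)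

  lowerʳ : ∀ {a b p d} → (a ∙ d ⊓ b ∙ p) ∙ d ∙ ε ≲ b ∙ d ∙ p ∙ ε
  lowerʳ {a} {b} {p} {d} = ∙-mono (∙-mono x⊓y≲y ≲-refl) ≲-refl
    ⨟ ≲-reflexive (solve 3 (λ b p d → ((b ⊕ p) ⊕ d) ⊕ id ⊜ ((b ⊕ d) ⊕ p) ⊕ id) ≈-refl b p d)

  -- After distributing over `⊔`, the summands missing from the hypotheses are supplied: `d` and `l`
  -- for the first, `b` and `k` for the second.
  least : ∀ {a b p d e f k l} → a ∙ f ∙ k ≲ b ∙ e ∙ k → p ∙ f ∙ l ≲ d ∙ e ∙ l →
          (a ∙ d ⊔ b ∙ p) ∙ f ∙ (k ∙ l) ≲ b ∙ d ∙ e ∙ (k ∙ l)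
  least {a} {b} {p} {d} {e} {f} {k} {l} h h' =
    ≲-reflexive (solve 4 (λ j f k l → (j ⊕ f) ⊕ (k ⊕ l) ⊜ j ⊕ (f ⊕ (k ⊕ l))) ≈-refl (a ∙ d ⊔ b ∙ p) f k l)
    ⨟ ∙-distrib-⊔
    ⨟ ⊔-least
      (≲-reflexive (solve 5 (λ a d f k l → (a ⊕ d) ⊕ (f ⊕ (k ⊕ l)) ⊜ ((a ⊕ f) ⊕ k) ⊕ (d ⊕ l)) ≈-refl a d f k l)
       ⨟ ∙-mono h ≲-refl
       ⨟ ≲-reflexive (solve 5 (λ b e d k l → ((b ⊕ e) ⊕ k) ⊕ (d ⊕ l) ⊜ ((b ⊕ d) ⊕ e) ⊕ (k ⊕ l)) ≈-refl b e d k l))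
      (≲-reflexive (solve 5 (λ b p f k l → (b ⊕ p) ⊕ (f ⊕ (k ⊕ l)) ⊜ ((p ⊕ f) ⊕ l) ⊕ (b ⊕ k)) ≈-refl b p f k l)
       ⨟ ∙-mono h' ≲-refl
       ⨟ ≲-reflexive (solve 5 (λ b e d k l → ((d ⊕ e) ⊕ l) ⊕ (b ⊕ k) ⊜ ((b ⊕ d) ⊕ e) ⊕ (k ⊕ l)) ≈-refl b e d k l))

  greatest : ∀ {a b p d e f k l} → e ∙ b ∙ k ≲ f ∙ a ∙ k → e ∙ d ∙ l ≲ f ∙ p ∙ l →
             e ∙ (b ∙ d) ∙ (k ∙ l) ≲ f ∙ (a ∙ d ⊓ b ∙ p) ∙ (k ∙ l)
  greatest {a} {b} {p} {d} {e} {f} {k} {l} h h' =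
    ⊓-greatest
      (≲-reflexive (solve 5 (λ b d e k l → (e ⊕ (b ⊕ d)) ⊕ (k ⊕ l) ⊜ ((e ⊕ b) ⊕ k) ⊕ (d ⊕ l)) ≈-refl b d e k l)
       ⨟ ∙-mono h ≲-refl
       ⨟ ≲-reflexive (solve 5 (λ a d f k l → ((f ⊕ a) ⊕ k) ⊕ (d ⊕ l) ⊜ (a ⊕ d) ⊕ (f ⊕ (k ⊕ l))) ≈-refl a d f k l))
      (≲-reflexive (solve 5 (λ b d e k l → (e ⊕ (b ⊕ d)) ⊕ (k ⊕ l) ⊜ ((e ⊕ d) ⊕ l) ⊕ (b ⊕ k)) ≈-refl b d e k l)
       ⨟ ∙-mono h' ≲-refl
       ⨟ ≲-reflexive (solve 5 (λ b p f k l → ((f ⊕ p) ⊕ l) ⊕ (b ⊕ k) ⊜ (b ⊕ p) ⊕ (f ⊕ (k ⊕ l))) ≈-refl b p f k l))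
    ⨟ ∙-distrib-⊓
    ⨟ ≲-reflexive (solve 4 (λ j f k l → j ⊕ (f ⊕ (k ⊕ l)) ⊜ (f ⊕ j) ⊕ (k ⊕ l)) ≈-refl (a ∙ d ⊓ b ∙ p) f k l)

  refl-law : ∀ a b → a ∙ b ≈ b ∙ a
  refl-law = solve 2 (λ a b → a ⊕ b ⊜ b ⊕ a) ≈-refl

  assoc-law : ∀ a b p d e f → ((a ∙ p) ∙ e) ∙ (b ∙ (d ∙ f)) ≈ ((b ∙ d) ∙ f) ∙ (a ∙ (p ∙ e))
  assoc-law = solve 6 (λ a b p d e f →
    ((a ⊕ p) ⊕ e) ⊕ (b ⊕ (d ⊕ f)) ⊜ ((b ⊕ d) ⊕ f) ⊕ (a ⊕ (p ⊕ e))) ≈-refl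

  comm-law : ∀ a b p d → (a ∙ p) ∙ (d ∙ b) ≈ (b ∙ d) ∙ (p ∙ a)
  comm-law = solve 4 (λ a b p d → (a ⊕ p) ⊕ (d ⊕ b) ⊜ (b ⊕ d) ⊕ (p ⊕ a)) ≈-refl

  identity-law : ∀ a b → (ε ∙ a) ∙ b ≈ (ε ∙ b) ∙ a
  identity-law = solve 2 (λ a b → (id ⊕ a) ⊕ b ⊜ (id ⊕ b) ⊕ a) ≈-refl

  inverse-law : ∀ a b → (b ∙ a) ∙ ε ≈ (a ∙ b) ∙ ε
  inverse-law = solve 2 (λ a b → (b ⊕ a) ⊕ id ⊜ (a ⊕ b) ⊕ id) ≈-refl

-- The laws of the Chang group.

module _ {c : Level} (L : BLAlgebra c) where
  open ChangGroup L
  open Order L using (≤-antisym; ≡⇒≤)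
  open Sequences L

  GoodSeq : Set c
  GoodSeq = Σ Seq IsGood

  values : ∀ {n} → Vec GoodSeq n → Fin n → Seq
  values ρ j = proj₁ (lookup ρ j)

  values-good : ∀ {n} (ρ : Vec GoodSeq n) j → IsGood (values ρ j)
  values-good ρ j = proj₂ (lookup ρ j)

  derive : ∀ {n} (ρ : Vec GoodSeq n) (X Y T : Expr n) (H : List (Expr n × Expr n)) →
           All (λ (e , f) → ⟦ e ⟧ (values ρ) ≤ₛ ⟦ f ⟧ (values ρ)) H →
           (∀ (M : LatticeMonoid c) σ → All (Holds M σ) H → Holds M σ (X ⊹ T , Y ⊹ T)) →
           ∃ λ k → IsGood k × (⟦ X ⟧ (values ρ) +ₛ k ≤ₛ ⟦ Y ⟧ (values ρ) +ₛ k)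
  derive ρ X Y T H hyps entails =
    Absorber.absorber (values ρ) (values-good ρ) T , Absorber.absorber-good (values ρ) (values-good ρ) T , Absorber.transfer (values ρ) (values-good ρ) T H X Y entails hyps

  -- The witness is built from the values and `T` alone, so both inequalities share it.
  derive-≐ : ∀ {n} (ρ : Vec GoodSeq n) (X Y T : Expr n) (H : List (Expr n × Expr n)) →
             All (λ (e , f) → ⟦ e ⟧ (values ρ) ≤ₛ ⟦ f ⟧ (values ρ)) H →
             (∀ (M : LatticeMonoid c) σ → All (Holds M σ) H → Holds M σ (X ⊹ T , Y ⊹ T)) →
             (∀ (M : LatticeMonoid c) σ → All (Holds M σ) H → Holds M σ (Y ⊹ T , X ⊹ T)) →
             ∃ λ k → IsGood k × (⟦ X ⟧ (values ρ) +ₛ k ≐ ⟦ Y ⟧ (values ρ) +ₛ k)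
  derive-≐ ρ X Y T H hyps forth back =
    Absorber.absorber (values ρ) (values-good ρ) T , Absorber.absorber-good (values ρ) (values-good ρ) T ,
    λ i → ≤-antisym (Absorber.transfer (values ρ) (values-good ρ) T H X Y forth hyps i) (Absorber.transfer (values ρ) (values-good ρ) T H Y X back hyps i)

  -- Even monoid identities pass through a witness, because sums in `L` cannot be reassociated
  -- freely.
  identity⇒≐ : ∀ {n} (ρ : Vec GoodSeq n) (X Y : Expr n) →
               (∀ (M : LatticeMonoid c) σ → LatticeMonoid._≈_ M (evaluate M σ X) (evaluate M σ Y)) →
               ∃ λ k → IsGood k × (⟦ X ⟧ (values ρ) +ₛ k ≐ ⟦ Y ⟧ (values ρ) +ₛ k)
  identity⇒≐ ρ X Y eq = derive-≐ ρ X Y null [] []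
    (λ M σ _ → ≲-refl-∙ M (eq M σ))
    (λ M σ _ → ≲-refl-∙ M (CommutativeMonoid.sym (LatticeMonoid.commutativeMonoid M) (eq M σ)))
    where
    ≲-refl-∙ : ∀ (M : LatticeMonoid c) {x y z} → LatticeMonoid._≈_ M x y →
               LatticeMonoid._≲_ M (LatticeMonoid._∙_ M x z) (LatticeMonoid._∙_ M y z)
    ≲-refl-∙ M p = LatticeMonoid.∙-mono M (LatticeMonoid.≲-reflexive M p) (Inequalities.≲-refl M)

  pattern #0 = var 0F
  pattern #1 = var 1F
  pattern #2 = var 2F
  pattern #3 = var 3F
  pattern #4 = var 4F
  pattern #5 = var 5F
  pattern #6 = var 6F
  pattern #7 = var 7F

  ∼⇒⪯ : ∀ {x y} → x ∼ y → x ⪯ y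
  ∼⇒⪯ (k , k-good , h) = k , k-good , λ i → ≡⇒≤ (h i)

  ∼⇒⪰ : ∀ {x y} → GoodPair x → GoodPair y → x ∼ y → y ⪯ x
  ∼⇒⪰ (ga , gb) (gp , gd) (k , gk , h) =
    derive ((_ , ga) ∷ (_ , gb) ∷ (_ , gp) ∷ (_ , gd) ∷ (_ , gk) ∷ [])
      (#2 ⊹ #1) (#3 ⊹ #0) #4 ((#1 ⊹ #2 ⊹ #4 , #0 ⊹ #3 ⊹ #4) ∷ [])
      ((λ i → ≡⇒≤ (sym (h i))) ∷ [])
      λ { M σ (h ∷ []) → Inequalities.flip M h }

  ⪯-antisymmetric : ∀ {x y} → GoodPair x → GoodPair y → x ⪯ y → y ⪯ x → x ∼ y
  ⪯-antisymmetric (ga , gb) (gp , gd) (k , gk , h) (l , gl , h') =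
    derive-≐ ((_ , ga) ∷ (_ , gb) ∷ (_ , gp) ∷ (_ , gd) ∷ (_ , gk) ∷ (_ , gl) ∷ [])
      (#0 ⊹ #3) (#1 ⊹ #2) (#4 ⊹ #5)
      ((#0 ⊹ #3 ⊹ #4 , #1 ⊹ #2 ⊹ #4) ∷ (#2 ⊹ #1 ⊹ #5 , #3 ⊹ #0 ⊹ #5) ∷ [])
      (h ∷ h' ∷ [])
      (λ { M σ (h ∷ _ ∷ []) → Inequalities.widenˡ M h })
      (λ { M σ (_ ∷ h' ∷ []) → Inequalities.flip-widenʳ M h' })

  ⪯-transitive : ∀ {x y z} → GoodPair x → GoodPair y → GoodPair z → x ⪯ y → y ⪯ z → x ⪯ z
  ⪯-transitive (ga , gb) (gp , gd) (ge , gf) (k , gk , h) (l , gl , h') =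
    derive ((_ , ga) ∷ (_ , gb) ∷ (_ , gp) ∷ (_ , gd) ∷ (_ , ge) ∷ (_ , gf) ∷ (_ , gk) ∷ (_ , gl) ∷ [])
      -- The common summand collects the middle pair and both given witnesses.
      (#0 ⊹ #5) (#1 ⊹ #4) ((#2 ⊹ #3) ⊹ (#6 ⊹ #7))
      ((#0 ⊹ #3 ⊹ #6 , #1 ⊹ #2 ⊹ #6) ∷ (#2 ⊹ #5 ⊹ #7 , #3 ⊹ #4 ⊹ #7) ∷ [])
      (h ∷ h' ∷ [])
      λ { M σ (h ∷ h' ∷ []) → Inequalities.chain M h h' }

  ⊞-monotone : ∀ {x x' y y'} → GoodPair x → GoodPair x' → GoodPair y → GoodPair y' →
               x ⪯ x' → y ⪯ y' → x ⊞ y ⪯ x' ⊞ y'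
  ⊞-monotone (ga , gb) (ga' , gb') (gp , gd) (gp' , gd') (k , gk , h) (l , gl , h') =
    derive ((_ , ga) ∷ (_ , gb) ∷ (_ , ga') ∷ (_ , gb') ∷ (_ , gp) ∷ (_ , gd) ∷ (_ , gp') ∷ (_ , gd')
            ∷ (_ , gk) ∷ (_ , gl) ∷ [])
      (#0 ⊹ #4 ⊹ (#3 ⊹ #7)) (#1 ⊹ #5 ⊹ (#2 ⊹ #6)) (var 8F ⊹ var 9F)
      ((#0 ⊹ #3 ⊹ var 8F , #1 ⊹ #2 ⊹ var 8F) ∷ (#4 ⊹ #7 ⊹ var 9F , #5 ⊹ #6 ⊹ var 9F) ∷ [])
      (h ∷ h' ∷ [])
      λ { M σ (h ∷ h' ∷ []) → Inequalities.add M h h' }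

  ∼-reflexive : ∀ {x} → GoodPair x → x ∼ x
  ∼-reflexive (ga , gb) = identity⇒≐ ((_ , ga) ∷ (_ , gb) ∷ []) (#0 ⊹ #1) (#1 ⊹ #0)
    λ M σ → Inequalities.refl-law M (σ 0F) (σ 1F)

  isChangLGroup : IsChangLGroup
  isChangLGroup = record
    { +ₛ-good = λ g h → Good⇒IsGood (+ₛ-Good (IsGood⇒Good g) (IsGood⇒Good h))
    ; ∨ₛ-good = λ g h → Good⇒IsGood (∨ₛ-Good (IsGood⇒Good g) (IsGood⇒Good h))
    ; ∧ₛ-good = λ g h → Good⇒IsGood (∧ₛ-Good (IsGood⇒Good g) (IsGood⇒Good h))
    ; 0ₛ-good = Good⇒IsGood 0ₛ-Good
    ; ∼-refl = ∼-reflexive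
    -- From here `∼` is handled as `⪯` in both directions, which reduces its laws to transitivity
    -- and monotonicity of `⪯`.
    ; ∼-sym = λ g h r → ⪯-antisymmetric h g (∼⇒⪰ g h r) (∼⇒⪯ r)
    ; ∼-trans = λ g h i r s → ⪯-antisymmetric g i
        (⪯-transitive g h i (∼⇒⪯ r) (∼⇒⪯ s)) (⪯-transitive i h g (∼⇒⪰ h i s) (∼⇒⪰ g h r))
    ; ⊞-cong = λ g g' h h' r s → ⪯-antisymmetric (⊞-good g h) (⊞-good g' h')
        (⊞-monotone g g' h h' (∼⇒⪯ r) (∼⇒⪯ s)) (⊞-monotone g' g h' h (∼⇒⪰ g g' r) (∼⇒⪰ h h' s))
    ; ⊞-assoc = λ (ga , gb) (gp , gd) (ge , gf) →
        identity⇒≐ ((_ , ga) ∷ (_ , gb) ∷ (_ , gp) ∷ (_ , gd) ∷ (_ , ge) ∷ (_ , gf) ∷ [])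
          (#0 ⊹ #2 ⊹ #4 ⊹ (#1 ⊹ (#3 ⊹ #5))) (#1 ⊹ #3 ⊹ #5 ⊹ (#0 ⊹ (#2 ⊹ #4)))
          λ M σ → Inequalities.assoc-law M (σ 0F) (σ 1F) (σ 2F) (σ 3F) (σ 4F) (σ 5F)
    ; ⊞-comm = λ (ga , gb) (gp , gd) →
        identity⇒≐ ((_ , ga) ∷ (_ , gb) ∷ (_ , gp) ∷ (_ , gd) ∷ [])
          (#0 ⊹ #2 ⊹ (#3 ⊹ #1)) (#1 ⊹ #3 ⊹ (#2 ⊹ #0))
          λ M σ → Inequalities.comm-law M (σ 0F) (σ 1F) (σ 2F) (σ 3F)
    ; ⊞-identity = λ (ga , gb) → identity⇒≐ ((_ , ga) ∷ (_ , gb) ∷ [])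
        (null ⊹ #0 ⊹ #1) (null ⊹ #1 ⊹ #0) λ M σ → Inequalities.identity-law M (σ 0F) (σ 1F)
    ; ⊞-inverse = λ (ga , gb) → identity⇒≐ ((_ , ga) ∷ (_ , gb) ∷ [])
        (#1 ⊹ #0 ⊹ null) (#0 ⊹ #1 ⊹ null) λ M σ → Inequalities.inverse-law M (σ 0F) (σ 1F)
    ; ⪯-resp-∼ = λ g g' h h' r s p → ⪯-transitive g' g h' (∼⇒⪰ g g' r) (⪯-transitive g h h' p (∼⇒⪯ s))
    ; ⪯-refl = λ g → ∼⇒⪯ (∼-reflexive g)
    ; ⪯-trans = ⪯-transitive
    ; ⪯-antisym = ⪯-antisymmetric
    ; ⪯-⊞ = λ g h i p → ⊞-monotone g h i i p (∼⇒⪯ (∼-reflexive i))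
    ; join-upperˡ = λ (ga , gb) (gp , gd) →
        derive ((_ , ga) ∷ (_ , gb) ∷ (_ , gp) ∷ (_ , gd) ∷ [])
          (#0 ⊹ (#1 ⊹ #3)) (#1 ⊹ (#0 ⊹ #3 ⊻ #1 ⊹ #2)) null [] [] λ M σ _ → Inequalities.upperˡ M
    ; join-upperʳ = λ (ga , gb) (gp , gd) →
        derive ((_ , ga) ∷ (_ , gb) ∷ (_ , gp) ∷ (_ , gd) ∷ [])
          (#2 ⊹ (#1 ⊹ #3)) (#3 ⊹ (#0 ⊹ #3 ⊻ #1 ⊹ #2)) null [] [] λ M σ _ → Inequalities.upperʳ M
    ; join-least = λ (ga , gb) (gp , gd) (ge , gf) (k , gk , h) (l , gl , h') →
        derive ((_ , ga) ∷ (_ , gb) ∷ (_ , gp) ∷ (_ , gd) ∷ (_ , ge) ∷ (_ , gf) ∷ (_ , gk) ∷ (_ , gl) ∷ [])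
          ((#0 ⊹ #3 ⊻ #1 ⊹ #2) ⊹ #5) (#1 ⊹ #3 ⊹ #4) (#6 ⊹ #7)
          ((#0 ⊹ #5 ⊹ #6 , #1 ⊹ #4 ⊹ #6) ∷ (#2 ⊹ #5 ⊹ #7 , #3 ⊹ #4 ⊹ #7) ∷ [])
          (h ∷ h' ∷ []) λ { M σ (h ∷ h' ∷ []) → Inequalities.least M h h' }
    ; meet-lowerˡ = λ (ga , gb) (gp , gd) →
        derive ((_ , ga) ∷ (_ , gb) ∷ (_ , gp) ∷ (_ , gd) ∷ [])
          ((#0 ⊹ #3 ⊼ #1 ⊹ #2) ⊹ #1) (#1 ⊹ #3 ⊹ #0) null [] [] λ M σ _ → Inequalities.lowerˡ M
    ; meet-lowerʳ = λ (ga , gb) (gp , gd) →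
        derive ((_ , ga) ∷ (_ , gb) ∷ (_ , gp) ∷ (_ , gd) ∷ [])
          ((#0 ⊹ #3 ⊼ #1 ⊹ #2) ⊹ #3) (#1 ⊹ #3 ⊹ #2) null [] [] λ M σ _ → Inequalities.lowerʳ M
    ; meet-greatest = λ (ga , gb) (gp , gd) (ge , gf) (k , gk , h) (l , gl , h') →
        derive ((_ , ga) ∷ (_ , gb) ∷ (_ , gp) ∷ (_ , gd) ∷ (_ , ge) ∷ (_ , gf) ∷ (_ , gk) ∷ (_ , gl) ∷ [])
          (#4 ⊹ (#1 ⊹ #3)) (#5 ⊹ (#0 ⊹ #3 ⊼ #1 ⊹ #2)) (#6 ⊹ #7)
          ((#4 ⊹ #1 ⊹ #6 , #5 ⊹ #0 ⊹ #6) ∷ (#4 ⊹ #3 ⊹ #7 , #5 ⊹ #2 ⊹ #7) ∷ [])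
          (h ∷ h' ∷ []) λ { M σ (h ∷ h' ∷ []) → Inequalities.greatest M h h' }
    }
    where
    ⊞-good : ∀ {x y} → GoodPair x → GoodPair y → GoodPair (x ⊞ y)
    ⊞-good (ga , gb) (gp , gd) = sum ga gp , sum gb gd
      where
      sum : ∀ {a b} → IsGood a → IsGood b → IsGood (a +ₛ b)
      sum g h = Good⇒IsGood (+ₛ-Good (IsGood⇒Good g) (IsGood⇒Good h))

theorem5p4 : ∀ {c : Level} (L : BLAlgebra c) → ChangGroup.IsChangLGroup L
theorem5p4 L = isChangLGroup L
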